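{- For every prime power $q$ and every integer $n\ge 2$, there exists an automata network $F:\mathrm{GF}(q)^n\to\mathrm{GF}(q)^n$ of degree at most $2$ which is near-Hamiltonian, i.e. whose dynamics consists of exactly one fixed point and one cycle of length $q^n-1$.
   Context: An automata network is a map $F:Q^V\to Q^V$, $V=\{1,\dots,n\}$, with local functions $f_j(x)=F(x)_j$. Its interaction graph has an arc $(i,j)$ iff $f_j$ effectively depends on $x_i$ (there exist $x,x'$ differing only at $i$ with $f_j(x)\neq f_j(x')$). The degree of $F$ is the maximum in-degree of its interaction graph. The dynamics of $F$ is the functional graph $x\mapsto F(x)$ on $Q^V$. -}

module Defs where

open import Data.Nat using (ℕ; zero; suc; _^_; _∸_; _<_; _≤_)
open import Data.Nat.Primality using (Prime)
open import Data.Fin using (Fin)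
open import Data.Vec using (Vec; lookup)
open import Data.List using (List; length)
open import Data.List.Membership.Propositional using (_∈_)
open import Data.Product using (Σ; ∃; _×_)
open import Relation.Binary.PropositionalEquality using (_≡_; _≢_)

IsPrimePower : ℕ → Set
IsPrimePower q = Σ ℕ λ p → Σ ℕ λ k → Prime p × q ≡ p ^ suc k

Config : ℕ → ℕ → Set
Config q n = Vec (Fin q) n

AutomataNetwork : ℕ → ℕ → Set
AutomataNetwork q n = Config q n → Config q n

local : ∀ {q n} → AutomataNetwork q n → Fin n → Config q n → Fin q
local F j x = lookup (F x) j

Arc : ∀ {q n} → AutomataNetwork q n → Fin n → Fin n → Set
Arc {q} {n} F i j =
  Σ (Config q n) λ x → Σ (Config q n) λ x' →
    (∀ (k : Fin n) → k ≢ i → lookup x k ≡ lookup x' k) × local F j x ≢ local F j x'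

InDegreeAtMost : ∀ {q n} → AutomataNetwork q n → ℕ → Fin n → Set
InDegreeAtMost {q} {n} F d j =
  Σ (List (Fin n)) λ L → length L ≤ d × (∀ (i : Fin n) → Arc F i j → i ∈ L)

DegreeAtMost : ∀ {q n} → AutomataNetwork q n → ℕ → Set
DegreeAtMost F d = ∀ j → InDegreeAtMost F d j

iterate : ∀ {A : Set} → (A → A) → ℕ → A → A
iterate f zero x = x
iterate f (suc k) x = f (iterate f k x)

NearHamiltonian : ∀ {q n} → AutomataNetwork q n → Set
NearHamiltonian {q} {n} F =
  Σ (Config q n) λ x0 → F x0 ≡ x0 ×
    Σ (Config q n) λ y → y ≢ x0 ×
      iterate F N y ≡ y ×
      (∀ (z : Config q n) → z ≢ x0 → Σ ℕ λ k → k < N × iterate F k y ≡ z)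
  where
  N : ℕ
  N = q ^ n ∸ 1

{-# OPTIONS --safe #-}
module Submission where

-- Let q = pᵏ, m = kn and N = pᵐ − 1. Multiplication by a root X of a primitive polynomial of degree m
-- over 𝔽ₚ, written in the basis 1, X, …, Xᵐ⁻¹, is a Galois shift register: every digit is computed from
-- its neighbour and from the leading digit. Putting the digits with index ≡ i (mod n) into cell i makes
-- cell i depend only on cell i + 1 and on cell 0, and the orbits are {0} and the N powers of X.
--
-- The field is found as 𝔽ₚ[X] / Ann(v) for an N-periodic sequence v : ℕ → 𝔽ₚ on which X acts as the
-- shift. The sequence is nonzero, is killed by 1 + X^(N/l) + … + X^((l-1)N/l) for every prime l ∣ N, so that X
-- has order N on it, and satisfies a monic relation of least possible degree d, so that the quotient
-- is a domain. Frobenius gives x^(N+1) = x there, so every nonzero element is a root of x^N − 1 and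
-- hence a power of X; comparing cardinalities, d = m.

open import Defs
open import Algebra.Bundles using (CommutativeRing)
open import Data.Nat as ℕ using (ℕ; zero; suc; _∸_; _!; NonZero; _≥_)
import Data.Nat.Properties as ℕ
open import Data.Nat.Combinatorics using (_C_; nCn≡1; nCk≡n!/k![n-k]!; k![n∸k]!∣n!)
open import Data.Nat.Coprimality using (prime⇒coprime; coprime-Bézout)
open import Data.Nat.Divisibility as ℕ using (_∣_; _∣?_; divides)
open import Data.Nat.DivMod
  using (_%_; _/_; _mod_; m≡m%n+[m/n]*n; m%n<n; m/n*n≡m; [m+kn]%n≡m%n; m<n⇒m%n≡m)
open import Data.Nat.GCD using (gcd; gcd-GCD; gcd[m,n]∣m; gcd[m,n]∣n; module Bézout)
open import Data.Nat.ListAction using (product)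
open import Data.Nat.Primality using (Prime; prime?; euclidsLemma; prime⇒nonZero; prime⇒nonTrivial)
open import Data.Nat.Primality.Factorisation using (factorise)
open import Data.Integer as ℤ using (ℤ; +_; 0ℤ; 1ℤ; -1ℤ)
import Data.Integer.Properties as ℤ
import Data.Integer.DivMod as ℤ
import Data.Integer.Divisibility.Signed as ℤ∣
open import Data.Integer.Tactic.RingSolver using (solve-∀)
open import Data.Fin as Fin using (Fin; zero; suc; toℕ; fromℕ<; finToFun; funToFin; combine; remQuot)
import Data.Fin.Properties as Fin
open import Data.Vec as Vec using (Vec; []; _∷_; _∷ʳ_; replicate; zipWith; lookup; tabulate)
import Data.Vec.Properties as Vec
import Data.List as List
open import Data.List.Membership.Propositional using (_∈_)
open import Data.List.Relation.Unary.All using (_∷_)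
open import Data.List.Relation.Unary.Any using (here; there)
open import Data.Product using (Σ; ∃; _×_; _,_; proj₁; proj₂)
open import Data.Sum using (inj₁; inj₂)
open import Function using (_∘_)
open import Level using (0ℓ)
open import Relation.Nullary using (¬_; contradiction; Dec; yes; no)
open import Relation.Nullary.Decidable using (map′; decidable-stable; _×-dec_; _→-dec_; ¬?)
open import Relation.Binary.Definitions using (tri<; tri≈; tri>)
open import Relation.Binary.PropositionalEquality as ≡ using (_≡_; _≢_; _≗_)

-- Binomial coefficients modulo a prime.

prime∤! : ∀ {p} → Prime p → ∀ k → k ℕ.< p → ¬ (p ∣ k !)
prime∤! {p} pr zero    k<p p∣1 = ℕ.<⇒≱ (ℕ.nonTrivial⇒n>1 p) (ℕ.∣⇒≤ p∣1)
  where instance _ = prime⇒nonTrivial pr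
prime∤! pr (suc k) k<p p∣ with euclidsLemma (suc k) (k !) pr p∣
... | inj₁ p∣1+k = ℕ.<⇒≱ k<p (ℕ.∣⇒≤ p∣1+k)
... | inj₂ p∣k!  = prime∤! pr k (ℕ.<-trans (ℕ.n<1+n k) k<p) p∣k!

-- `p` divides `p ! = (p C k) k! (p - k)!`, and both factorials are products of numbers below `p`,
-- so Euclid's lemma leaves the binomial coefficient.
prime∣C : ∀ {p} → Prime p → ∀ k → 0 ℕ.< k → k ℕ.< p → p ∣ (p C k)
prime∣C {p@(suc p-1)} pr k 0<k k<p with euclidsLemma (p C k) (k ! ℕ.* (p ∸ k) !) pr p∣C*
  where
  k≤p : k ℕ.≤ p
  k≤p = ℕ.<⇒≤ k<p
  instance _ = ℕ._!*_!≢0 k (p ∸ k)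
  C*≡p! : (p C k) ℕ.* (k ! ℕ.* (p ∸ k) !) ≡ p !
  C*≡p! = ≡.trans (≡.cong (ℕ._* (k ! ℕ.* (p ∸ k) !)) (nCk≡n!/k![n-k]! k≤p)) (m/n*n≡m (k![n∸k]!∣n! k≤p))
  p∣C* : p ∣ (p C k) ℕ.* (k ! ℕ.* (p ∸ k) !)
  p∣C* = ≡.subst (p ∣_) (≡.sym C*≡p!) (ℕ.m∣m*n (p-1 !))
... | inj₁ p∣C = p∣C
... | inj₂ p∣! with euclidsLemma (k !) ((p ∸ k) !) pr p∣!
...   | inj₁ p∣k! = contradiction p∣k! (prime∤! pr k k<p)
...   | inj₂ p∣r! = contradiction p∣r! (prime∤! pr (p ∸ k) (ℕ.∸-monoʳ-< 0<k (ℕ.<⇒≤ k<p)))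

-- Frobenius, and roots of monic polynomials in commutative rings.

module RingLemmas {c ℓ} (R : CommutativeRing c ℓ) where

  open CommutativeRing R hiding (zero)
  open import Algebra.Properties.Ring ring using (-‿distribʳ-*)
  open import Algebra.Properties.CommutativeSemiring.Exp commutativeSemiring
  open import Algebra.Properties.Semiring.Mult semiring
    using (×-assocˡ; ×-assoc-*; ×-congʳ; ×-homo-1) renaming (_×_ to infixr 8 _·_)
  open import Algebra.Properties.Semiring.Sum semiring using (sum; sum-init-last; sum-cong-≋; sum-replicate-zero)
  open import Algebra.Properties.CommutativeSemiring.Binomial commutativeSemiring using (theorem; binomialTerm)
  open import Relation.Binary.Reasoning.Setoid setoid
  open import Algebra.Solver.Ring.NaturalCoefficients.Default commutativeSemiring using (solve; _:=_; _:+_; _:*_)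

  ×-zero : ∀ n → n · 0# ≈ 0#
  ×-zero zero    = refl
  ×-zero (suc n) = trans (+-identityˡ _) (×-zero n)

  module _ {p} (p-prime : Prime p) (char : p · 1# ≈ 0#) where

    multiple≈0 : ∀ {n} x → p ∣ n → n · x ≈ 0#
    multiple≈0 x (ℕ.divides k ≡.refl) = begin
      (k ℕ.* p) · x        ≈⟨ ×-assocˡ x k p ⟨
      k · (p · x)          ≈⟨ ×-congʳ k (×-congʳ p (*-identityˡ x)) ⟨
      k · (p · (1# * x))   ≈⟨ ×-congʳ k (×-assoc-* p 1# x) ⟨
      k · (p · 1# * x)     ≈⟨ ×-congʳ k (trans (*-congʳ char) (zeroˡ x)) ⟩
      k · 0#               ≈⟨ ×-zero k ⟩
      0#                   ∎

    -- In the binomial expansion every term but the two outer ones has a coefficient divisible by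
    -- `p`, which vanishes in characteristic `p`.
    frobenius : ∀ x y → (x + y) ^ p ≈ x ^ p + y ^ p
    frobenius x y = go p ≡.refl
      where
      -- The exponent becomes a variable so that it can be matched as a successor, which exposes the
      -- first and last terms of the sum.
      go : ∀ n → n ≡ p → (x + y) ^ n ≈ x ^ n + y ^ n
      go zero    ≡.refl with () ← prime⇒nonZero p-prime
      go n@(suc n-1) ≡.refl = begin
        (x + y) ^ n                              ≈⟨ theorem n x y ⟩
        t zero + sum (t ∘ suc)                   ≈⟨ +-congˡ (sum-init-last (t ∘ suc)) ⟩
        t zero + (sum (λ i → t (suc (Fin.inject₁ i))) + t (Fin.fromℕ n))
          ≈⟨ +-cong first (+-cong (trans (sum-cong-≋ middle) (sum-replicate-zero n-1)) final) ⟩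
        y ^ n + (0# + x ^ n)                     ≈⟨ +-congˡ (+-identityˡ _) ⟩
        y ^ n + x ^ n                            ≈⟨ +-comm _ _ ⟩
        x ^ n + y ^ n                            ∎
        where
        t : Fin (suc n) → Carrier
        t = binomialTerm x y n

        first : t zero ≈ y ^ n
        first = trans (×-homo-1 _) (*-identityˡ _)

        middle : ∀ i → t (suc (Fin.inject₁ i)) ≈ 0#
        middle i = multiple≈0 _ (prime∣C p-prime _ ℕ.z<s
          (ℕ.s<s (≡.subst (ℕ._< n-1) (≡.sym (Fin.toℕ-inject₁ i)) (Fin.toℕ<n i))))

        top : ∀ {k a b} → k ≡ n → a ≡ 1 → b ≡ 0 → a · (x ^ k * y ^ b) ≈ x ^ n
        top ≡.refl ≡.refl ≡.refl = trans (×-homo-1 _) (*-identityʳ _)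

        final : t (Fin.fromℕ n) ≈ x ^ n
        final = top k≡n (≡.trans (≡.cong (n C_) k≡n) (nCn≡1 n)) (≡.trans (≡.cong (n ∸_) k≡n) (ℕ.n∸n≡0 n))
          where k≡n = Fin.toℕ-fromℕ n

    frobenius-iterate : ∀ m x y → (x + y) ^ (p ℕ.^ m) ≈ x ^ (p ℕ.^ m) + y ^ (p ℕ.^ m)
    frobenius-iterate zero    x y = trans (*-identityʳ _) (sym (+-cong (*-identityʳ _) (*-identityʳ _)))
    frobenius-iterate (suc m) x y = begin
      (x + y) ^ (p ℕ.* p ℕ.^ m)             ≈⟨ ^-assocʳ (x + y) p (p ℕ.^ m) ⟨
      ((x + y) ^ p) ^ (p ℕ.^ m)             ≈⟨ ^-congˡ (p ℕ.^ m) (frobenius x y) ⟩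
      (x ^ p + y ^ p) ^ (p ℕ.^ m)           ≈⟨ frobenius-iterate m (x ^ p) (y ^ p) ⟩
      (x ^ p) ^ (p ℕ.^ m) + (y ^ p) ^ (p ℕ.^ m)
        ≈⟨ +-cong (^-assocʳ x p (p ℕ.^ m)) (^-assocʳ y p (p ℕ.^ m)) ⟩
      x ^ (p ℕ.* p ℕ.^ m) + y ^ (p ℕ.* p ℕ.^ m) ∎

  x≈y+[x-y] : ∀ x y → x ≈ y + (x - y)
  x≈y+[x-y] x y = begin
    x              ≈⟨ +-identityʳ x ⟨
    x + 0#         ≈⟨ +-congˡ (-‿inverseˡ y) ⟨
    x + (- y + y)  ≈⟨ +-assoc x (- y) y ⟨
    (x - y) + y    ≈⟨ +-comm _ _ ⟩
    y + (x - y)    ∎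

  x-y≈0⇒x≈y : ∀ {x y} → x - y ≈ 0# → x ≈ y
  x-y≈0⇒x≈y {x} {y} h = trans (x≈y+[x-y] x y) (trans (+-congˡ h) (+-identityʳ y))

  affine-rearrange : ∀ x y z P A B → (x + z * y) * P + (A + z * B) ≈ (x * P + A) + z * (y * P + B)
  affine-rearrange = solve 6 (λ x y z P A B →
    ((x :+ z :* y) :* P :+ (A :+ z :* B)) := ((x :* P :+ A) :+ z :* (y :* P :+ B))) refl

  shift-rearrange : ∀ c x P A → c * (x * P) + x * A ≈ x * (c * P + A)
  shift-rearrange = solve 4 (λ c x P A → (c :* (x :* P) :+ x :* A) := (x :* (c :* P :+ A))) refl

  -- `w` is minus the inverse of `z`: adding `w` times the vanishing `z * P + A` to `P` cancels the
  -- leading term. This makes a relation monic.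
  solve-leading : ∀ {z w P A} → 1# + w * z ≈ 0# → z * P + A ≈ 0# → P ≈ w * A
  solve-leading {z} {w} {P} {A} 1+wz≈0 zP+A≈0 = begin
    P                      ≈⟨ +-identityʳ P ⟨
    P + 0#                 ≈⟨ +-congˡ (trans (*-congˡ zP+A≈0) (zeroʳ w)) ⟨
    P + w * (z * P + A)    ≈⟨ +-congʳ (*-identityˡ P) ⟨
    1# * P + w * (z * P + A)
      ≈⟨ solve 5 (λ u z w P A → (u :* P :+ w :* (z :* P :+ A)) := ((u :+ w :* z) :* P :+ w :* A)) refl 1# z w P A ⟩
    (1# + w * z) * P + w * A   ≈⟨ +-congʳ (trans (*-congʳ 1+wz≈0) (zeroˡ P)) ⟩
    0# + w * A             ≈⟨ +-identityˡ _ ⟩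
    w * A                  ∎

  geometric-step : ∀ y g q → g * (1# - y) ≈ 1# - q → (1# + y * g) * (1# - y) ≈ 1# - y * q
  geometric-step y g q h = begin
    (1# + y * g) * (1# - y)            ≈⟨ trans (distribʳ _ _ _) (+-congˡ (*-assoc y g _)) ⟩
    1# * (1# - y) + y * (g * (1# - y)) ≈⟨ +-cong (*-identityˡ _) (*-congˡ h) ⟩
    (1# - y) + y * (1# - q)            ≈⟨ +-congˡ (trans (distribˡ y 1# (- q)) (+-congʳ (*-identityʳ y))) ⟩
    (1# - y) + (y + y * - q)           ≈⟨ +-congˡ (+-congˡ (-‿distribʳ-* y q)) ⟨
    (1# - y) + (y - y * q)
      ≈⟨ solve 4 (λ u m y z → ((u :+ m) :+ (y :+ z)) := ((m :+ y) :+ (u :+ z))) refl 1# (- y) y (- (y * q)) ⟩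
    (- y + y) + (1# - y * q)           ≈⟨ trans (+-congʳ (-‿inverseˡ y)) (+-identityˡ _) ⟩
    1# - y * q                         ∎

  -- The value at x of the monic polynomial c₀ + c₁ x + … + cₙ₋₁ xⁿ⁻¹ + xⁿ.
  monic : ∀ {n} → Vec Carrier n → Carrier → Carrier
  monic []       x = 1#
  monic (c ∷ cs) x = c + x * monic cs x

  -- Horner's scheme: the values of the proper tails of `f` at `a` become the coefficients of the
  -- quotient, and the value of `f` itself is the remainder.
  synthetic-division : ∀ {n} (f : Vec Carrier (suc n)) a →
    Σ (Vec Carrier n) λ g → ∀ x → monic f x ≈ monic f a + (x - a) * monic g x
  synthetic-division (c ∷ []) a = [] , λ x → trans (+-congˡ (*-congʳ (x≈y+[x-y] x a)))
    (solve 4 (λ c u a d → (c :+ (a :+ d) :* u) := ((c :+ a :* u) :+ d :* u)) refl c 1# a (x - a))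
  synthetic-division (c ∷ cs@(_ ∷ _)) a with g , eq ← synthetic-division cs a =
    monic cs a ∷ g , λ x → begin
      c + x * monic cs x
        ≈⟨ +-congˡ (*-cong (x≈y+[x-y] x a) (eq x)) ⟩
      c + (a + (x - a)) * (monic cs a + (x - a) * monic g x)
        ≈⟨ solve 5 (λ c a d v w → (c :+ (a :+ d) :* (v :+ d :* w)) := ((c :+ a :* v) :+ d :* (v :+ (a :+ d) :* w)))
             refl c a (x - a) (monic cs a) (monic g x) ⟩
      (c + a * monic cs a) + (x - a) * (monic cs a + (a + (x - a)) * monic g x)
        ≈⟨ +-congˡ (*-congˡ (+-congˡ (*-congʳ (x≈y+[x-y] x a)))) ⟨
      (c + a * monic cs a) + (x - a) * (monic cs a + x * monic g x)  ∎

  module _ (1≉0 : ¬ 1# ≈ 0#) (cancel : ∀ {x y} → ¬ x ≈ 0# → x * y ≈ 0# → y ≈ 0#) where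

    -- Induction on the degree: dividing by `x - r zero` leaves a monic quotient that vanishes at
    -- all the other points, since the differences `r (suc i) - r zero` can be cancelled.
    too-many-roots : ∀ {n} (f : Vec Carrier n) (r : Fin (suc n) → Carrier) →
      (∀ i j → i ≢ j → ¬ r i ≈ r j) → ¬ (∀ i → monic f (r i) ≈ 0#)
    too-many-roots []         r distinct roots = 1≉0 (roots zero)
    too-many-roots f@(_ ∷ _) r distinct roots with g , eq ← synthetic-division f (r zero) =
      too-many-roots g (r ∘ suc) (λ i j i≢j → distinct (suc i) (suc j) (i≢j ∘ Fin.suc-injective))
        λ i → cancel {r (suc i) - r zero} (λ z → distinct (suc i) zero (λ ()) (x-y≈0⇒x≈y z)) (begin
          (r (suc i) - r zero) * monic g (r (suc i))                        ≈⟨ +-identityˡ _ ⟨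
          0# + (r (suc i) - r zero) * monic g (r (suc i))                   ≈⟨ +-congʳ (roots zero) ⟨
          monic f (r zero) + (r (suc i) - r zero) * monic g (r (suc i))     ≈⟨ eq (r (suc i)) ⟨
          monic f (r (suc i))                                               ≈⟨ roots (suc i) ⟩
          0#                                                                ∎)

-- Congruence of integers modulo p.

module Modular (p : ℕ) where

  infix 4 _≋_

  -- The multiplier is stored, so that each congruence law below becomes one identity for the ring
  -- solver.
  record _≋_ (a b : ℤ) : Set where
    constructor by
    field
      multiplier : ℤ
      equation   : a ≡ b ℤ.+ multiplier ℤ.* + p

  ≋-reflexive : ∀ {a b} → a ≡ b → a ≋ b
  ≋-reflexive {a} ≡.refl = by 0ℤ (identity a (+ p))
    where
    identity : ∀ a p → a ≡ a ℤ.+ 0ℤ ℤ.* p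
    identity = solve-∀

  ≋-refl : ∀ {a} → a ≋ a
  ≋-refl = ≋-reflexive ≡.refl

  ≋-sym : ∀ {a b} → a ≋ b → b ≋ a
  ≋-sym {b = b} (by k ≡.refl) = by (ℤ.- k) (identity b k (+ p))
    where
    identity : ∀ b k p → b ≡ (b ℤ.+ k ℤ.* p) ℤ.+ ℤ.- k ℤ.* p
    identity = solve-∀

  ≋-trans : ∀ {a b c} → a ≋ b → b ≋ c → a ≋ c
  ≋-trans {c = c} (by k ≡.refl) (by l ≡.refl) = by (l ℤ.+ k) (identity c l k (+ p))
    where
    identity : ∀ c l k p → (c ℤ.+ l ℤ.* p) ℤ.+ k ℤ.* p ≡ c ℤ.+ (l ℤ.+ k) ℤ.* p
    identity = solve-∀

  +-cong : ∀ {a b c d} → a ≋ b → c ≋ d → a ℤ.+ c ≋ b ℤ.+ d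
  +-cong {b = b} {d = d} (by k ≡.refl) (by l ≡.refl) = by (k ℤ.+ l) (identity b d k l (+ p))
    where
    identity : ∀ b d k l p → (b ℤ.+ k ℤ.* p) ℤ.+ (d ℤ.+ l ℤ.* p) ≡ (b ℤ.+ d) ℤ.+ (k ℤ.+ l) ℤ.* p
    identity = solve-∀

  *-cong : ∀ {a b c d} → a ≋ b → c ≋ d → a ℤ.* c ≋ b ℤ.* d
  *-cong {b = b} {d = d} (by k ≡.refl) (by l ≡.refl) =
    by (b ℤ.* l ℤ.+ k ℤ.* d ℤ.+ k ℤ.* l ℤ.* + p) (identity b d k l (+ p))
    where
    identity : ∀ b d k l p → (b ℤ.+ k ℤ.* p) ℤ.* (d ℤ.+ l ℤ.* p) ≡
                             b ℤ.* d ℤ.+ (b ℤ.* l ℤ.+ k ℤ.* d ℤ.+ k ℤ.* l ℤ.* p) ℤ.* p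
    identity = solve-∀

  p≋0 : + p ≋ 0ℤ
  p≋0 = by 1ℤ (identity (+ p))
    where
    identity : ∀ p → p ≡ 0ℤ ℤ.+ 1ℤ ℤ.* p
    identity = solve-∀

  ≋⇒∣ : ∀ {a b} → a ≋ b → + p ℤ∣.∣ a ℤ.- b
  ≋⇒∣ {b = b} (by k ≡.refl) = ℤ∣.divides k (identity b k (+ p))
    where
    identity : ∀ b k p → (b ℤ.+ k ℤ.* p) ℤ.- b ≡ k ℤ.* p
    identity = solve-∀

  ∣⇒≋ : ∀ {a b} → + p ℤ∣.∣ a ℤ.- b → a ≋ b
  ∣⇒≋ {a} {b} (ℤ∣.divides k eq) = by k (≡.trans (identity a b) (≡.cong (λ c → b ℤ.+ c) eq))
    where
    identity : ∀ a b → a ≡ b ℤ.+ (a ℤ.- b)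
    identity = solve-∀

  _≋?_ : ∀ a b → Dec (a ≋ b)
  a ≋? b = map′ ∣⇒≋ ≋⇒∣ (+ p ℤ∣.∣? a ℤ.- b)

-- Polynomials acting on sequences.

-- Expressions denote integer polynomials; X acts on sequences as the left shift.
infixl 6 _⊕_
infixl 7 _⊗_

data Expr : Set where
  con : ℤ → Expr
  X   : Expr
  _⊕_ : Expr → Expr → Expr
  _⊗_ : Expr → Expr → Expr

pow : Expr → ℕ → Expr
pow e zero    = con 1ℤ
pow e (suc n) = e ⊗ pow e n

geometric : Expr → ℕ → Expr
geometric e zero    = con 0ℤ
geometric e (suc n) = con 1ℤ ⊕ e ⊗ geometric e n

Sequence : Set
Sequence = ℕ → ℤ

-- Products act by composition, which makes associativity and one distributive law of the quotient
-- ring hold by `refl`.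
act : Expr → Sequence → Sequence
act (con z) v a = z ℤ.* v a
act X       v a = v (suc a)
act (e ⊕ f) v a = act e v a ℤ.+ act f v a
act (e ⊗ f) v   = act e (act f v)

act-cong : ∀ e {v w} → v ≗ w → act e v ≗ act e w
act-cong (con z) v≗w a = ≡.cong (z ℤ.*_) (v≗w a)
act-cong X       v≗w a = v≗w (suc a)
act-cong (e ⊕ f) v≗w a = ≡.cong₂ ℤ._+_ (act-cong e v≗w a) (act-cong f v≗w a)
act-cong (e ⊗ f) v≗w   = act-cong e (act-cong f v≗w)

act-+ : ∀ e v w → act e (λ a → v a ℤ.+ w a) ≗ λ a → act e v a ℤ.+ act e w a
act-+ (con z) v w a = ℤ.*-distribˡ-+ z (v a) (w a)
act-+ X       v w a = ≡.refl
act-+ (e ⊕ f) v w a = ≡.trans (≡.cong₂ ℤ._+_ (act-+ e v w a) (act-+ f v w a))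
  (identity (act e v a) _ _ _)
  where
  identity : ∀ a b c d → (a ℤ.+ b) ℤ.+ (c ℤ.+ d) ≡ (a ℤ.+ c) ℤ.+ (b ℤ.+ d)
  identity = solve-∀
act-+ (e ⊗ f) v w a = ≡.trans (act-cong e (act-+ f v w) a) (act-+ e (act f v) (act f w) a)

act-scale : ∀ e z v → act e (λ a → z ℤ.* v a) ≗ λ a → z ℤ.* act e v a
act-scale (con y) z v a = identity y z (v a)
  where
  identity : ∀ y z a → y ℤ.* (z ℤ.* a) ≡ z ℤ.* (y ℤ.* a)
  identity = solve-∀
act-scale X       z v a = ≡.refl
act-scale (e ⊕ f) z v a = ≡.trans (≡.cong₂ ℤ._+_ (act-scale e z v a) (act-scale f z v a))
  (≡.sym (ℤ.*-distribˡ-+ z (act e v a) (act f v a)))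
act-scale (e ⊗ f) z v a = ≡.trans (act-cong e (act-scale f z v) a) (act-scale e z (act f v) a)

act-shift : ∀ e v → act e (v ∘ suc) ≗ act e v ∘ suc
act-shift (con z) v a = ≡.refl
act-shift X       v a = ≡.refl
act-shift (e ⊕ f) v a = ≡.cong₂ ℤ._+_ (act-shift e v a) (act-shift f v a)
act-shift (e ⊗ f) v a = ≡.trans (act-cong e (act-shift f v) a) (act-shift e (act f v) a)

-- Scalings and shifts commute with every action, and sums and products inherit this. Both the
-- commutativity of the quotient ring and the compatibility of its product with equality rest on it.
act-comm : ∀ e f v → act e (act f v) ≗ act f (act e v)
act-comm (con z)  f v a = ≡.sym (act-scale f z v a)
act-comm X        f v a = ≡.sym (act-shift f v a)
act-comm (e ⊕ e′) f v a = ≡.trans (≡.cong₂ ℤ._+_ (act-comm e f v a) (act-comm e′ f v a))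
  (≡.sym (act-+ f (act e v) (act e′ v) a))
act-comm (e ⊗ e′) f v a = ≡.trans (act-cong e (act-comm e′ f v) a) (act-comm e f (act e′ v) a)

-- The quotient ring attached to a sequence.

module _ (p : ℕ) where

  open Modular p

  act-≋ : ∀ e {v w} → (∀ a → v a ≋ w a) → ∀ a → act e v a ≋ act e w a
  act-≋ (con z) v≋w a = *-cong (≋-refl {z}) (v≋w a)
  act-≋ X       v≋w a = v≋w (suc a)
  act-≋ (e ⊕ f) v≋w a = +-cong (act-≋ e v≋w a) (act-≋ f v≋w a)
  act-≋ (e ⊗ f) v≋w   = act-≋ e (act-≋ f v≋w)

  -- A record rather than the bare function type, so that `v`, `e` and `f` can be recovered by
  -- unification.
  record Agree (v : Sequence) (e f : Expr) : Set where
    constructor agree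
    field
      at : ∀ a → act e v a ≋ act f v a

  open Agree public

  -- The quotient of 𝔽ₚ[X] by the annihilator of v.
  cyclic : Sequence → CommutativeRing 0ℓ 0ℓ
  cyclic v = record
    { Carrier = Expr ; _≈_ = Agree v ; _+_ = _⊕_ ; _*_ = _⊗_
    ; -_ = con -1ℤ ⊗_ ; 0# = con 0ℤ ; 1# = con 1ℤ
    ; isCommutativeRing = record
      { isRing = record
        { +-isAbelianGroup = record
          { isGroup = record
            { isMonoid = record
              { isSemigroup = record
                { isMagma = record
                  { isEquivalence = record
                    { refl  = agree λ a → ≋-refl
                    ; sym   = λ (agree r) → agree λ a → ≋-sym (r a)
                    ; trans = λ (agree r) (agree s) → agree λ a → ≋-trans (r a) (s a)
                    }
                  ; ∙-cong = λ (agree r) (agree s) → agree λ a → +-cong (r a) (s a)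
                  }
                ; assoc = λ e f g → exactly λ a → ℤ.+-assoc (act e v a) _ _
                }
              ; identity = (λ e → exactly λ a → ℤ.+-identityˡ (act e v a))
                         , (λ e → exactly λ a → ℤ.+-identityʳ (act e v a))
              }
            ; inverse = (λ e → exactly λ a → inverseˡ (act e v a) (v a))
                      , (λ e → exactly λ a → inverseʳ (act e v a) (v a))
            ; ⁻¹-cong = λ (agree r) → agree λ a → *-cong (≋-refl { -1ℤ}) (r a)
            }
          ; comm = λ e f → exactly λ a → ℤ.+-comm (act e v a) _
          }
        -- The hypothesis on `e` and `e′` concerns `v` only, not `act f′ v`, so the operators are
        -- commuted before `e` is replaced.
        ; *-cong = λ {e} {e′} {f} {f′} (agree r) (agree s) → agree λ a →
            ≋-trans (act-≋ e s a) (≋-trans (≋-reflexive (act-comm e f′ v a))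
              (≋-trans (act-≋ f′ r a) (≋-reflexive (act-comm f′ e′ v a))))
        ; *-assoc = λ e f g → exactly λ a → ≡.refl
        ; *-identity = (λ e → exactly λ a → ℤ.*-identityˡ (act e v a))
                     , (λ e → exactly λ a → act-cong e (ℤ.*-identityˡ ∘ v) a)
        ; distrib = (λ e f g → exactly λ a → act-+ e (act f v) (act g v) a)
                  , (λ e f g → exactly λ a → ≡.refl)
        }
      ; *-comm = λ e f → exactly λ a → act-comm e f v a
      }
    }
    where
    exactly : ∀ {e f} → act e v ≗ act f v → Agree v e f
    exactly h = agree λ a → ≋-reflexive (h a)

    inverseˡ : ∀ a b → -1ℤ ℤ.* a ℤ.+ a ≡ 0ℤ ℤ.* b
    inverseˡ = solve-∀

    inverseʳ : ∀ a b → a ℤ.+ -1ℤ ℤ.* a ≡ 0ℤ ℤ.* b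
    inverseʳ = solve-∀

  Agree-act : ∀ e {v f g} → Agree v f g → Agree (act e v) f g
  Agree-act e {v} {f} {g} (agree r) = agree λ a →
    ≋-trans (≋-reflexive (act-comm f e v a)) (≋-trans (act-≋ e r a) (≋-reflexive (act-comm e g v a)))

  con0≋ : ∀ v w a → act (con 0ℤ) v a ≋ act (con 0ℤ) w a
  con0≋ v w a = ≋-reflexive (≡.trans (ℤ.*-zeroˡ (v a)) (≡.sym (ℤ.*-zeroˡ (w a))))

  -- Products act by composition, so only the two zeros, taken on different sequences, have to be
  -- identified. This passes between the quotient rings of `v` and of `act e v`.
  ⊗≈0⇒≈0 : ∀ {v f} e → Agree v (f ⊗ e) (con 0ℤ) → Agree (act e v) f (con 0ℤ)
  ⊗≈0⇒≈0 {v} e (agree r) = agree λ a → ≋-trans (r a) (con0≋ v (act e v) a)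

  ≈0⇒⊗≈0 : ∀ {v f} e → Agree (act e v) f (con 0ℤ) → Agree v (f ⊗ e) (con 0ℤ)
  ≈0⇒⊗≈0 {v} e (agree r) = agree λ a → ≋-trans (r a) (con0≋ (act e v) v a)

  act-pow-X : ∀ n v a → act (pow X n) v a ≡ v (n ℕ.+ a)
  act-pow-X zero    v a = ℤ.*-identityˡ (v a)
  act-pow-X (suc n) v a = ≡.trans (act-pow-X n v (suc a)) (≡.cong v (ℕ.+-suc n a))

  -- The values of `act e v` repeat modulo `p` with period `N`, so `N` comparisons decide an
  -- equation in the quotient.
  Agree? : ∀ {N v} → .{{NonZero N}} → Agree v (pow X N) (con 1ℤ) → ∀ e f → Dec (Agree v e f)
  Agree? {N} {v} period e f = map′
    (λ r → agree λ a → ≋-trans (reduce e a) (≋-trans (r (m%n<n a N)) (≋-sym (reduce f a))))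
    (λ (agree r) {a} _ → r a)
    (ℕ.allUpTo? (λ a → act e v a ≋? act f v a) N)
    where
    step : ∀ e a → act e v (N ℕ.+ a) ≋ act e v a
    step e a = ≋-trans (≋-reflexive (≡.sym (act-pow-X N (act e v) a)))
      (≋-trans (at (Agree-act e {f = pow X N} period) a) (≋-reflexive (ℤ.*-identityˡ _)))

    steps : ∀ e k a → act e v (a ℕ.+ k ℕ.* N) ≋ act e v a
    steps e zero    a = ≋-reflexive (≡.cong (act e v) (ℕ.+-identityʳ a))
    steps e (suc k) a = ≋-trans (≋-reflexive (≡.cong (act e v) rearrange))
      (≋-trans (step e (a ℕ.+ k ℕ.* N)) (steps e k a))
      where
      rearrange : a ℕ.+ (N ℕ.+ k ℕ.* N) ≡ N ℕ.+ (a ℕ.+ k ℕ.* N)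
      rearrange = ≡.trans (≡.sym (ℕ.+-assoc a N _))
        (≡.trans (≡.cong (ℕ._+ k ℕ.* N) (ℕ.+-comm a N)) (ℕ.+-assoc N a _))

    reduce : ∀ e a → act e v a ≋ act e v (a % N)
    reduce e a = ≋-trans (≋-reflexive (≡.cong (act e v) (m≡m%n+[m/n]*n a N))) (steps e (a / N) (a % N))

module CyclicLemmas (p : ℕ) (v : Sequence) where

  private
    R : CommutativeRing 0ℓ 0ℓ
    R = cyclic p v

  open CommutativeRing R hiding (zero)
  open import Algebra.Properties.CommutativeSemiring.Exp commutativeSemiring
  open import Relation.Binary.Reasoning.Setoid setoid

  pow≡^ : ∀ e n → pow e n ≡ e ^ n
  pow≡^ e zero    = ≡.refl
  pow≡^ e (suc n) = ≡.cong (e ⊗_) (pow≡^ e n)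

  pow-* : ∀ e m n → pow (pow e m) n ≈ pow e (m ℕ.* n)
  pow-* e m n rewrite pow≡^ (pow e m) n | pow≡^ e m | pow≡^ e (m ℕ.* n) = ^-assocʳ e m n

  pow-+ : ∀ e m n → pow e (m ℕ.+ n) ≈ pow e m * pow e n
  pow-+ e m n rewrite pow≡^ e (m ℕ.+ n) | pow≡^ e m | pow≡^ e n = ^-homo-* e m n

  pow-cong : ∀ {e f} n → e ≈ f → pow e n ≈ pow f n
  pow-cong {e} {f} n e≈f rewrite pow≡^ e n | pow≡^ f n = ^-congˡ n e≈f

  pow-⊗ : ∀ e f n → pow (e * f) n ≈ pow e n * pow f n
  pow-⊗ e f n rewrite pow≡^ (e * f) n | pow≡^ e n | pow≡^ f n = ^-distrib-* e f n

  pow-1 : ∀ n → pow 1# n ≈ 1#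
  pow-1 zero    = refl
  pow-1 (suc n) = trans (*-identityˡ _) (pow-1 n)

  geometric-sum : ∀ e n → geometric e n * (1# - e) ≈ 1# - pow e n
  geometric-sum e zero    = trans (zeroˡ _) (sym (-‿inverseʳ 1#))
  geometric-sum e (suc n) = RingLemmas.geometric-step R e (geometric e n) (pow e n) (geometric-sum e n)

-- Admissible sequences and their existence.

record Admissible (p N : ℕ) (v : Sequence) : Set where
  field
    period     : Agree p v (pow X N) (con 1ℤ)
    cyclotomic : ∀ l t → Prime l → l ℕ.* t ≡ N → Agree p v (geometric (pow X t) l) (con 0ℤ)

open Admissible public

-- Both conditions are equations between polynomials on `v`, so they pass to every `act e v`. The
-- minimality argument depends on this stability.
Admissible-act : ∀ {p N v} e → Admissible p N v → Admissible p N (act e v)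
Admissible-act {p} {N} e adm = record
  { period     = Agree-act p e {f = pow X N} (period adm)
  ; cyclotomic = λ l t l-prime eq → Agree-act p e {f = geometric (pow X t) l} (cyclotomic adm l t l-prime eq)
  }

-- Multiplying the indicator of Nℤ by 1 − X^(N/l) for every prime l ∣ N kills it under each
-- 1 + X^(N/l) + … + X^((l-1)N/l), but keeps its value at 0: the support of the product over the primes
-- below l stays in (N/P)ℤ with P prime to l, which misses N/l.
module _ (p N : ℕ) .{{_ : NonZero N}} where

  private
    -- Stage `b` has dealt with the primes below `b`; in the construction `P` is the product of
    -- those that divide `N`. The condition `N ∣ P ℕ.* a` expresses that `a` is a multiple of
    -- `N / P` without a division.
    record Partial (b : ℕ) (v : Sequence) : Set where
      field
        periodic : Agree p v (pow X N) (con 1ℤ)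
        killed   : ∀ l t → Prime l → l ℕ.< b → l ℕ.* t ≡ N → Agree p v (geometric (pow X t) l) (con 0ℤ)
        P        : ℕ
        prime-to : ∀ l → Prime l → b ℕ.≤ l → ¬ l ∣ P
        support  : ∀ a → ¬ N ∣ P ℕ.* a → v a ≡ 0ℤ
        v0≡1     : v 0 ≡ 1ℤ

    open Partial

    indicator : Sequence
    indicator a with N ∣? a
    ... | yes _ = 1ℤ
    ... | no _  = 0ℤ

    indicator-periodic : ∀ a → indicator (N ℕ.+ a) ≡ indicator a
    indicator-periodic a with N ∣? N ℕ.+ a | N ∣? a
    ... | yes _ | yes _ = ≡.refl
    ... | no _  | no _  = ≡.refl
    ... | yes h | no h′ = contradiction (ℕ.∣m+n∣m⇒∣n h ℕ.∣-refl) h′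
    ... | no h  | yes h′ = contradiction (ℕ.∣m∣n⇒∣m+n ℕ.∣-refl h′) h

    indicator-support : ∀ a → ¬ N ∣ 1 ℕ.* a → indicator a ≡ 0ℤ
    indicator-support a h with N ∣? a
    ... | yes h′ = contradiction (≡.subst (N ∣_) (≡.sym (ℕ.*-identityˡ a)) h′) h
    ... | no _   = ≡.refl

    indicator-0 : indicator 0 ≡ 1ℤ
    indicator-0 with N ∣? 0
    ... | yes _ = ≡.refl
    ... | no h  = contradiction (N ℕ.∣0) h

    start : Partial 0 indicator
    start = record
      { periodic = agree λ a → Modular.≋-reflexive p
          (≡.trans (act-pow-X p N indicator a) (≡.trans (indicator-periodic a) (≡.sym (ℤ.*-identityˡ _))))
      ; killed   = λ l t l-prime ()
      ; P        = 1
      ; prime-to = λ l l-prime _ l∣1 → prime∤! l-prime 0 (ℕ.>-nonZero⁻¹ l {{prime⇒nonZero l-prime}}) l∣1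
      ; support  = indicator-support
      ; v0≡1     = indicator-0
      }

    skip : ∀ {b v} → ¬ (Prime b × b ∣ N) → Partial b v → Partial (suc b) v
    skip {b} {v} h s = record
      { periodic = periodic s
      ; killed   = killed′
      ; P        = P s
      ; prime-to = λ l l-prime b<l → prime-to s l l-prime (ℕ.<⇒≤ b<l)
      ; support  = support s
      ; v0≡1     = v0≡1 s
      }
      where
      killed′ : ∀ l t → Prime l → l ℕ.< suc b → l ℕ.* t ≡ N → Agree p v (geometric (pow X t) l) (con 0ℤ)
      killed′ l t l-prime l≤b eq with ℕ.m≤n⇒m<n∨m≡n (ℕ.s≤s⁻¹ l≤b)
      ... | inj₁ l<b    = killed s l t l-prime l<b eq
      ... | inj₂ ≡.refl = contradiction (l-prime , divides t (≡.trans (≡.sym eq) (ℕ.*-comm l t))) h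

    extend : ∀ {b v} → Prime b → b ∣ N → Partial b v → ∃ (Partial (suc b))
    extend {b} {v} b-prime (divides t N≡tb) s = w , record
      { periodic = Agree-act p D {f = pow X N} (periodic s)
      ; killed   = killed′
      ; P        = P s ℕ.* b
      ; prime-to = prime-to′
      ; support  = support′
      -- `w 0` is `v 0 - v t`, and `v t` vanishes: `N = t b` dividing `P t` would force `b ∣ P`.
      ; v0≡1     = ≡.trans (w≡ 0) (≡.cong₂ ℤ._-_ (v0≡1 s)
          (support s (t ℕ.+ 0) (λ h → prime-to s b b-prime ℕ.≤-refl (b∣P h))))
      }
      where
      open CyclicLemmas p v
      open CommutativeRing (cyclic p v) using (setoid; -‿cong; +-congˡ; -‿inverseʳ)
      open import Relation.Binary.Reasoning.Setoid setoid

      D : Expr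
      D = con 1ℤ ⊕ con -1ℤ ⊗ pow X t

      w : Sequence
      w = act D v

      w≡ : ∀ a → w a ≡ v a ℤ.- v (t ℕ.+ a)
      w≡ a = ≡.cong₂ ℤ._+_ (ℤ.*-identityˡ (v a)) (≡.trans (ℤ.-1*i≡-i _) (≡.cong ℤ.-_ (act-pow-X p t v a)))

      killed′ : ∀ l u → Prime l → l ℕ.< suc b → l ℕ.* u ≡ N → Agree p w (geometric (pow X u) l) (con 0ℤ)
      killed′ l u l-prime l≤b eq with ℕ.m≤n⇒m<n∨m≡n (ℕ.s≤s⁻¹ l≤b)
      ... | inj₁ l<b    = Agree-act p D {f = geometric (pow X u) l} (killed s l u l-prime l<b eq)
      ... | inj₂ ≡.refl with ≡.refl ←
        ℕ.*-cancelʳ-≡ u t b {{prime⇒nonZero b-prime}} (≡.trans (ℕ.*-comm u b) (≡.trans eq N≡tb)) =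
        -- The geometric sum in `X^t` times `1 - X^t` telescopes to `1 - X^N`, which vanishes by
        -- periodicity.
        ⊗≈0⇒≈0 p {f = geometric (pow X t) b} D (begin
          geometric (pow X t) b ⊗ D             ≈⟨ geometric-sum (pow X t) b ⟩
          con 1ℤ ⊕ con -1ℤ ⊗ pow (pow X t) b    ≈⟨ +-congˡ {con 1ℤ} (-‿cong {pow (pow X t) b} (pow-* X t b)) ⟩
          con 1ℤ ⊕ con -1ℤ ⊗ pow X (t ℕ.* b)    ≡⟨ ≡.cong (λ n → con 1ℤ ⊕ con -1ℤ ⊗ pow X n) N≡tb ⟨
          con 1ℤ ⊕ con -1ℤ ⊗ pow X N            ≈⟨ +-congˡ {con 1ℤ} (-‿cong {pow X N} (periodic s)) ⟩
          con 1ℤ ⊕ con -1ℤ ⊗ con 1ℤ             ≈⟨ -‿inverseʳ (con 1ℤ) ⟩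
          con 0ℤ                                ∎)

      prime-to′ : ∀ l → Prime l → suc b ℕ.≤ l → ¬ l ∣ P s ℕ.* b
      prime-to′ l l-prime b<l l∣ with euclidsLemma (P s) b l-prime l∣
      ... | inj₁ l∣P = prime-to s l l-prime (ℕ.<⇒≤ b<l) l∣P
      ... | inj₂ l∣b = ℕ.<⇒≱ b<l (ℕ.∣⇒≤ {{prime⇒nonZero b-prime}} l∣b)

      support′ : ∀ a → ¬ N ∣ P s ℕ.* b ℕ.* a → w a ≡ 0ℤ
      support′ a h = ≡.trans (w≡ a) (≡.cong₂ ℤ._-_
        (support s a (λ N∣Pa → h (≡.subst (N ∣_) (rearrange₁ a) (ℕ.∣n⇒∣m*n b N∣Pa))))
        -- Since `b P (t + a) = P N + P b a`, from `N ∣ P (t + a)` would follow `N ∣ P b a`.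
        (support s (t ℕ.+ a) (λ N∣P[t+a] → h (ℕ.∣m+n∣m⇒∣n
          (≡.subst (N ∣_) rearrange₂ (ℕ.∣n⇒∣m*n b N∣P[t+a])) (ℕ.n∣m*n (P s))))))
        where
        rearrange₁ : ∀ a → b ℕ.* (P s ℕ.* a) ≡ P s ℕ.* b ℕ.* a
        rearrange₁ a = ≡.trans (≡.sym (ℕ.*-assoc b (P s) a)) (≡.cong (ℕ._* a) (ℕ.*-comm b (P s)))

        rearrange₂ : b ℕ.* (P s ℕ.* (t ℕ.+ a)) ≡ P s ℕ.* N ℕ.+ P s ℕ.* b ℕ.* a
        rearrange₂ = ≡.trans (rearrange₁ (t ℕ.+ a)) (≡.trans (ℕ.*-distribˡ-+ (P s ℕ.* b) t a)
          (≡.cong (ℕ._+ P s ℕ.* b ℕ.* a)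
          (≡.trans (ℕ.*-assoc (P s) b t) (≡.cong (P s ℕ.*_) (≡.trans (ℕ.*-comm b t) (≡.sym N≡tb))))))

      b∣P : N ∣ P s ℕ.* (t ℕ.+ 0) → b ∣ P s
      b∣P h = ℕ.*-cancelˡ-∣ t {{ℕ.m*n≢0⇒m≢0 t {{≡.subst NonZero N≡tb it}}}}
        (≡.subst₂ _∣_ N≡tb (≡.trans (≡.cong (P s ℕ.*_) (ℕ.+-identityʳ t)) (ℕ.*-comm (P s) t)) h)
        where
        it : NonZero N
        it = ℕ.≢-nonZero (ℕ.≢-nonZero⁻¹ N)

    partial : ∀ b → ∃ (Partial b)
    partial zero    = indicator , start
    partial (suc b) with v , s ← partial b with prime? b | b ∣? N
    ... | yes b-prime | yes b∣N = extend b-prime b∣N s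
    ... | no ¬prime   | _       = v , skip (λ (b-prime , _) → ¬prime b-prime) s
    ... | yes _       | no b∤N  = v , skip (λ (_ , b∣N) → b∤N b∣N) s

  admissible-sequence : ∃ λ v → Admissible p N v × v 0 ≡ 1ℤ
  -- A prime divisor of `N` is at most `N`, so stage `suc N` covers all of them.
  admissible-sequence with v , s ← partial (suc N) = v , record
    { period     = periodic s
    ; cyclotomic = λ l t l-prime eq → killed s l t l-prime
        (ℕ.s≤s (ℕ.∣⇒≤ (divides t (≡.trans (≡.sym eq) (ℕ.*-comm l t))))) eq
    } , v0≡1 s

prime-divisor : ∀ n → 1 ℕ.< n → ∃ λ l → Prime l × l ∣ n
prime-divisor n@(suc _) 1<n with factorise n
... | record { factors = List.[]       ; isFactorisation = eq } = contradiction eq (ℕ.>⇒≢ 1<n)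
... | record { factors = l List.∷ ls ; isFactorisation = eq ; factorsPrime = l-prime ∷ _ } =
  l , l-prime , divides (product ls) (≡.trans eq (ℕ.*-comm l _))

-- Digits modulo p, vectors of digits and the shift register.

module Digits (p : ℕ) .{{_ : NonZero p}} where

  open Modular p

  residue : ℤ → Fin p
  residue z = fromℕ< (ℤ.n%ℕd<d z p)

  digit : Fin p → ℤ
  digit i = + toℕ i

  digit-residue : ∀ z → digit (residue z) ≋ z
  digit-residue z = ≋-trans (≋-reflexive (≡.cong +_ (Fin.toℕ-fromℕ< (ℤ.n%ℕd<d z p))))
    (≋-sym (by (z ℤ./ℕ p) (ℤ.a≡a%ℕn+[a/ℕn]*n z p)))

  digit-injective : ∀ {i j} → digit i ≋ digit j → i ≡ j
  digit-injective {i} {j} i≋j = Fin.toℕ-injective (ℤ.+-injective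
    (ℤ.i-j≡0⇒i≡j (digit i) (digit j) (ℤ.∣i∣≡0⇒i≡0 (zero-of p∣ bound))))
    where
    p∣ : p ∣ ℤ.∣ digit i ℤ.- digit j ∣
    p∣ = ℤ∣.∣⇒∣ᵤ (≋⇒∣ i≋j)

    bound : ℤ.∣ digit i ℤ.- digit j ∣ ℕ.< p
    bound = ≡.subst (λ z → ℤ.∣ z ∣ ℕ.< p) (≡.sym (ℤ.m-n≡m⊖n (toℕ i) (toℕ j)))
      (ℕ.≤-<-trans (ℤ.∣m⊝n∣≤m⊔n (toℕ i) (toℕ j)) (ℕ.⊔-lub (Fin.toℕ<n i) (Fin.toℕ<n j)))

    zero-of : ∀ {n} → p ∣ n → n ℕ.< p → n ≡ 0
    zero-of {zero}  _   _   = ≡.refl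
    zero-of {suc n} p∣n n<p = contradiction (ℕ.∣⇒≤ p∣n) (ℕ.<⇒≱ n<p)

  -- Bézout's identity for `p` and the residue of `z`; its two sign patterns give `w = y` and
  -- `w = -y`. The negated inverse is the form needed to solve a relation for its leading power.
  negative-inverse : Prime p → ∀ z → ¬ z ≋ 0ℤ → ∃ λ w → 1ℤ ℤ.+ w ℤ.* z ≋ 0ℤ
  negative-inverse p-prime z z≉0 with residue z in eq | digit-residue z
  ... | i | i≋z with coprime-Bézout (prime⇒coprime p-prime {{ℕ.≢-nonZero i≢0}} (Fin.toℕ<n i))
    where
    i≢0 : toℕ i ≢ 0
    i≢0 i≡0 = z≉0 (≋-trans (≋-sym i≋z) (≋-reflexive (≡.cong +_ i≡0)))
  ...   | Bézout.+- x y eq′ = + y , ≋-trans (+-cong (≋-refl {1ℤ}) (*-cong (≋-refl {+ y}) (≋-sym i≋z)))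
    (≋-trans (≋-reflexive (≡.trans (≡.cong (λ a → 1ℤ ℤ.+ a) (≡.sym (ℤ.pos-* y (toℕ i))))
      (≡.trans (≡.cong +_ eq′) (ℤ.pos-* x p))))
      (≋-trans (*-cong (≋-refl {+ x}) p≋0) (≋-reflexive (ℤ.*-zeroʳ (+ x)))))
  ...   | Bézout.-+ x y eq′ = ℤ.- + y , ≋-trans (+-cong (≋-refl {1ℤ}) (*-cong (≋-refl {ℤ.- + y}) (≋-sym i≋z)))
    (by (ℤ.- + x) (identity (+ x) (+ y) (+ toℕ i) (+ p)
      (≡.trans (≡.cong (λ a → 1ℤ ℤ.+ a) (≡.sym (ℤ.pos-* x p))) (≡.trans (≡.cong +_ eq′) (ℤ.pos-* y (toℕ i))))))
    where
    expand : ∀ x y i p → 1ℤ ℤ.+ ℤ.- y ℤ.* i ≡ ((1ℤ ℤ.+ x ℤ.* p) ℤ.- y ℤ.* i) ℤ.+ ℤ.- x ℤ.* p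
    expand = solve-∀

    identity : ∀ x y i p → 1ℤ ℤ.+ x ℤ.* p ≡ y ℤ.* i → 1ℤ ℤ.+ ℤ.- y ℤ.* i ≡ 0ℤ ℤ.+ ℤ.- x ℤ.* p
    identity x y i p h = ≡.trans (expand x y i p)
      (≡.cong (ℤ._+ ℤ.- x ℤ.* p) (≡.trans (≡.cong (ℤ._- y ℤ.* i) h) (ℤ.+-inverseʳ (y ℤ.* i))))

  0⃗ : ∀ {n} → Vec (Fin p) n
  0⃗ = replicate _ (residue 0ℤ)

  affine : ∀ {n} → ℤ → Vec (Fin p) n → Vec (Fin p) n → Vec (Fin p) n
  affine z = zipWith λ x y → residue (digit x ℤ.+ z ℤ.* digit y)

  -- Multiplication by X modulo Xⁿ − b, the leading coefficient coming first.
  lfsr : ∀ {n} → Vec (Fin p) n → Vec (Fin p) n → Vec (Fin p) n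
  lfsr b []       = []
  lfsr b (c ∷ cs) = affine (digit c) (cs ∷ʳ residue 0ℤ) b

  -- With the leading coefficient first, dropping a zero head lowers the degree bound.
  combination : ∀ {n} → Vec (Fin p) n → Expr
  combination []               = con 0ℤ
  combination {suc n} (c ∷ cs) = con (digit c) ⊗ pow X n ⊕ combination cs

  -- Taking `z = -1` makes `affine` a difference, which reduces injectivity of `combination` to a
  -- trivial kernel.
  affine-injective : ∀ {n} (xs ys : Vec (Fin p) n) → affine -1ℤ xs ys ≡ 0⃗ → xs ≡ ys
  affine-injective []       []       _  = ≡.refl
  affine-injective (x ∷ xs) (y ∷ ys) eq with eq₁ , eq₂ ← Vec.∷-injective eq =
    ≡.cong₂ _∷_ (digit-injective (∣⇒≋ (≋⇒∣′ (≋-trans (≋-sym (digit-residue _))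
      (≋-trans (≋-reflexive (≡.cong digit eq₁)) (digit-residue 0ℤ)))))) (affine-injective xs ys eq₂)
    where
    ≋⇒∣′ : digit x ℤ.+ -1ℤ ℤ.* digit y ≋ 0ℤ → + p ℤ∣.∣ digit x ℤ.- digit y
    ≋⇒∣′ h = ≡.subst (+ p ℤ∣.∣_)
      (≡.trans (ℤ.+-identityʳ _) (≡.cong (λ a → digit x ℤ.+ a) (ℤ.-1*i≡-i (digit y)))) (≋⇒∣ h)

  module _ (v : Sequence) where

    open CommutativeRing (cyclic p v) hiding (zero; +-cong; *-cong)
    private module R = CommutativeRing (cyclic p v)
    open CyclicLemmas p v
    open RingLemmas (cyclic p v) using (affine-rearrange; shift-rearrange)
    open import Relation.Binary.Reasoning.Setoid setoid

    con-cong : ∀ {y z} → y ≋ z → con y ≈ con z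
    con-cong y≋z = agree λ a → *-cong y≋z (≋-refl {v a})

    con-+ : ∀ y z → con (y ℤ.+ z) ≈ con y + con z
    con-+ y z = agree λ a → ≋-reflexive (ℤ.*-distribʳ-+ (v a) y z)

    con-* : ∀ y z → con (y ℤ.* z) ≈ con y * con z
    con-* y z = agree λ a → ≋-reflexive (ℤ.*-assoc y z (v a))

    combination-0⃗ : ∀ n → combination (0⃗ {n}) ≈ 0#
    combination-0⃗ zero    = refl
    combination-0⃗ (suc n) = trans
      (R.+-cong (trans (*-congʳ (con-cong (digit-residue 0ℤ))) (zeroˡ (pow X n))) (combination-0⃗ n))
      (+-identityˡ 0#)

    combination-affine : ∀ {n} z (xs ys : Vec (Fin p) n) →
      combination (affine z xs ys) ≈ combination xs + con z * combination ys
    combination-affine z []               []       = sym (trans (+-identityˡ _) (zeroʳ (con z)))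
    combination-affine {suc n} z (x ∷ xs) (y ∷ ys) = begin
      con (digit (residue (digit x ℤ.+ z ℤ.* digit y))) * pow X n + combination (affine z xs ys)
        ≈⟨ R.+-cong (*-congʳ (trans (con-cong (digit-residue _)) (trans (con-+ _ _) (+-congˡ (con-* z (digit y))))))
             (combination-affine z xs ys) ⟩
      (con (digit x) + con z * con (digit y)) * pow X n + (combination xs + con z * combination ys)
        ≈⟨ affine-rearrange (con (digit x)) (con (digit y)) (con z) (pow X n) (combination xs) (combination ys) ⟩
      combination (x ∷ xs) + con z * combination (y ∷ ys) ∎

    combination-∷ʳ : ∀ {n} (xs : Vec (Fin p) n) → combination (xs ∷ʳ residue 0ℤ) ≈ X * combination xs
    combination-∷ʳ []               = trans (combination-0⃗ 1) (sym (zeroʳ X))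
    combination-∷ʳ {suc n} (x ∷ xs) = trans (+-congˡ (combination-∷ʳ xs))
      (shift-rearrange (con (digit x)) X (pow X n) (combination xs))

    -- Multiplying by `X` shifts the digits and raises the leading one to `X ^ n`, which `rel`
    -- replaces by `combination b`.
    combination-lfsr : ∀ {n} {b : Vec (Fin p) n} → pow X n ≈ combination b →
      ∀ c → combination (lfsr b c) ≈ X * combination c
    combination-lfsr rel [] = sym (zeroʳ X)
    combination-lfsr {suc n} {b} rel (c ∷ cs) = begin
      combination (affine (digit c) (cs ∷ʳ residue 0ℤ) b)
        ≈⟨ combination-affine (digit c) (cs ∷ʳ residue 0ℤ) b ⟩
      combination (cs ∷ʳ residue 0ℤ) + con (digit c) * combination b
        ≈⟨ R.+-cong (combination-∷ʳ cs) (*-congˡ (sym rel)) ⟩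
      X * combination cs + con (digit c) * (X * pow X n)
        ≈⟨ +-comm _ _ ⟩
      con (digit c) * (X * pow X n) + X * combination cs
        ≈⟨ shift-rearrange (con (digit c)) X (pow X n) (combination cs) ⟩
      X * combination (c ∷ cs)                                     ∎

    one-combination : ∀ n → ∃ λ (c : Vec (Fin p) (suc n)) → combination c ≈ 1#
    one-combination zero    = residue 1ℤ ∷ [] ,
      trans (+-identityʳ _) (trans (*-identityʳ _) (con-cong (digit-residue 1ℤ)))
    one-combination (suc n) with c , c≈1 ← one-combination n =
      residue 0ℤ ∷ c , trans
        (R.+-cong (trans (*-congʳ (con-cong (digit-residue 0ℤ))) (zeroˡ (pow X (suc n)))) c≈1)
        (+-identityˡ 1#)

-- Vectors as elements of a finite set.

encode : ∀ {m n} → Vec (Fin m) n → Fin (m ℕ.^ n)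
encode xs = funToFin (lookup xs)

decode : ∀ {m n} → Fin (m ℕ.^ n) → Vec (Fin m) n
decode i = tabulate (finToFun i)

funToFin-cong : ∀ {m n} {f g : Fin n → Fin m} → f ≗ g → funToFin f ≡ funToFin g
funToFin-cong {n = zero}  f≗g = ≡.refl
funToFin-cong {n = suc n} f≗g = ≡.cong₂ Fin.combine (f≗g zero) (funToFin-cong (f≗g ∘ suc))

decode-encode : ∀ {m n} (xs : Vec (Fin m) n) → decode (encode xs) ≡ xs
decode-encode xs = ≡.trans (Vec.tabulate-cong (Fin.finToFun-funToFin (lookup xs))) (Vec.tabulate∘lookup xs)

encode-decode : ∀ {m n} (i : Fin (m ℕ.^ n)) → encode {m} {n} (decode i) ≡ i
encode-decode {m} {n} i =
  ≡.trans (funToFin-cong {m} {n} (Vec.lookup∘tabulate (finToFun {m} {n} i))) (Fin.funToFin-finToFin {n} {m} i)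

-- Order of X, Frobenius and primitive registers.

module Primitivity (p m N′ : ℕ) (p-prime : Prime p) (m≢0 : m ≢ 0) (q≡ : suc (suc N′) ≡ p ℕ.^ m) where

  instance
    p≢0 : NonZero p
    p≢0 = prime⇒nonZero p-prime

  open Modular p using (_≋_; _≋?_; ≋-sym; ≋-trans; p≋0; ≋⇒∣)
  open Digits p

  N : ℕ
  N = suc N′

  Nontrivial : Sequence → Set
  Nontrivial v = ¬ Agree p v (con 1ℤ) (con 0ℤ)

  -- The sequence is quantified inside: minimality of `d` then also speaks about the sequences
  -- `act x v`, and that is what excludes zero divisors.
  Annihilated : ℕ → Set
  Annihilated d = ∃ λ v → Admissible p N v × Nontrivial v ×
    ∃ λ (b : Vec (Fin p) d) → Agree p v (pow X d) (combination b)

  Primitive : (b y : Vec (Fin p) m) → Set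
  Primitive b y = lfsr b 0⃗ ≡ 0⃗ × y ≢ 0⃗ × iterate (lfsr b) N y ≡ y ×
    (∀ z → z ≢ 0⃗ → ∃ λ k → k ℕ.< N × iterate (lfsr b) k y ≡ z)

  module _ (v : Sequence) (adm : Admissible p N v) (1≉0 : Nontrivial v) where

    open CommutativeRing (cyclic p v) hiding (zero)
    open CyclicLemmas p v
    open RingLemmas (cyclic p v)
    open import Algebra.Properties.Semiring.Mult semiring using () renaming (_×_ to infixr 8 _·_)
    open import Relation.Binary.Reasoning.Setoid setoid

    private
      _≈?_ : ∀ e f → Dec (e ≈ f)
      _≈?_ = Agree? p {N} (period adm)

    pow-period : ∀ k → pow X (N ℕ.* k) ≈ 1#
    pow-period k = trans (sym (pow-* X N k)) (trans (pow-cong {pow X N} k (period adm)) (pow-1 k))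

    characteristic : p · 1# ≈ 0#
    characteristic = trans (multiple p) (con-cong v p≋0)
      where
      multiple : ∀ n → n · 1# ≈ con (+ n)
      multiple zero    = refl
      multiple (suc n) = trans (+-congˡ (multiple n)) (sym (con-+ v 1ℤ (+ n)))

    pow-additive : ∀ {n} → n ≡ p ℕ.^ m → ∀ e f → pow (e + f) n ≈ pow e n + pow f n
    pow-additive {n} ≡.refl e f rewrite pow≡^ (e + f) n | pow≡^ e n | pow≡^ f n =
      frobenius-iterate p-prime characteristic m e f

    -- Raising to the power `p ^ m` is additive by Frobenius and multiplicative, so the generators
    -- suffice: `X` by its period, constants by passing to a natural number and adding `1`
    -- repeatedly.
    fixed : ∀ e → pow e (suc N) ≈ e
    fixed (con z) = trans (pow-cong (suc N) z≈i) (trans (natural (toℕ (residue z))) (sym z≈i))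
      where
      z≈i : con z ≈ con (digit (residue z))
      z≈i = con-cong v (≋-sym (digit-residue z))

      natural : ∀ k → pow (con (+ k)) (suc N) ≈ con (+ k)
      natural zero    = zeroˡ (pow (con 0ℤ) N)
      natural (suc k) = begin
        pow (con (+ suc k)) (suc N)                    ≈⟨ pow-cong (suc N) (con-+ v 1ℤ (+ k)) ⟩
        pow (con 1ℤ + con (+ k)) (suc N)               ≈⟨ pow-additive q≡ (con 1ℤ) (con (+ k)) ⟩
        pow (con 1ℤ) (suc N) + pow (con (+ k)) (suc N) ≈⟨ +-cong (pow-1 (suc N)) (natural k) ⟩
        con 1ℤ + con (+ k)                             ≈⟨ con-+ v 1ℤ (+ k) ⟨
        con (+ suc k)                                  ∎
    fixed X       = trans (*-congˡ {X} {pow X N} (period adm)) (*-identityʳ X)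
    fixed (e ⊕ f) = trans (pow-additive q≡ e f) (+-cong (fixed e) (fixed f))
    fixed (e ⊗ f) = trans (pow-⊗ e f (suc N)) (*-cong (fixed e) (fixed f))

    -- A proper divisor g of N divides N / l for a prime l; X^g = 1 then turns the cyclotomic relation
    -- at l into l = 0, although l is invertible modulo p.
    order : ∀ k → 0 ℕ.< k → k ℕ.< N → ¬ pow X k ≈ 1#
    order k 0<k k<N X^k≈1 = 1≉0 1≈0
      where
      g = gcd k N

      X^g≈1 : pow X g ≈ 1#
      X^g≈1 with Bézout.identity (gcd-GCD k N)
      ... | Bézout.+- x y eq = begin
        pow X g                        ≈⟨ *-identityʳ (pow X g) ⟨
        pow X g * 1#                   ≈⟨ *-congˡ {pow X g} (pow-period y) ⟨
        pow X g * pow X (N ℕ.* y)      ≈⟨ pow-+ X g (N ℕ.* y) ⟨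
        pow X (g ℕ.+ N ℕ.* y)
          ≡⟨ ≡.cong (pow X) (≡.trans (≡.cong (g ℕ.+_) (ℕ.*-comm N y)) (≡.trans eq (ℕ.*-comm x k))) ⟩
        pow X (k ℕ.* x)                ≈⟨ pow-* X k x ⟨
        pow (pow X k) x                ≈⟨ trans (pow-cong x X^k≈1) (pow-1 x) ⟩
        1#                             ∎
      ... | Bézout.-+ x y eq = begin
        pow X g                        ≈⟨ *-identityʳ (pow X g) ⟨
        pow X g * 1#                   ≈⟨ *-congˡ {pow X g} (trans (pow-cong x X^k≈1) (pow-1 x)) ⟨
        pow X g * pow (pow X k) x      ≈⟨ *-congˡ {pow X g} (pow-* X k x) ⟩
        pow X g * pow X (k ℕ.* x)      ≈⟨ pow-+ X g (k ℕ.* x) ⟨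
        pow X (g ℕ.+ k ℕ.* x)
          ≡⟨ ≡.cong (pow X) (≡.trans (≡.cong (g ℕ.+_) (ℕ.*-comm k x)) (≡.trans eq (ℕ.*-comm y N))) ⟩
        pow X (N ℕ.* y)                ≈⟨ pow-period y ⟩
        1#                             ∎

      geometric-1 : ∀ {e} n → e ≈ 1# → geometric e n ≈ con (+ n)
      geometric-1 zero    e≈1 = refl
      geometric-1 (suc n) e≈1 = trans
        (+-congˡ (trans (*-cong e≈1 (geometric-1 n e≈1)) (*-identityˡ _)))
        (sym (con-+ v 1ℤ (+ n)))

      prime≈0 : ∃ λ l → l ∣ N × con (+ l) ≈ 0#
      prime≈0 with divides s N≡sg ← gcd[m,n]∣n k N
        with l , l-prime , divides t s≡tl ← prime-divisor s (ℕ.≰⇒> λ s≤1 →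
          ℕ.<⇒≱ k<N (ℕ.≤-trans (ℕ.≤-reflexive N≡sg) (ℕ.≤-trans (ℕ.*-monoˡ-≤ g s≤1)
            (ℕ.≤-trans (ℕ.≤-reflexive (ℕ.*-identityˡ g)) (ℕ.∣⇒≤ {{ℕ.>-nonZero 0<k}} (gcd[m,n]∣m k N)))))) =
        l , divides (g ℕ.* t) (≡.sym (≡.trans (ℕ.*-comm (g ℕ.* t) l) l*gt≡N)) ,
        trans (sym (geometric-1 l X^gt≈1)) (cyclotomic adm l (g ℕ.* t) l-prime l*gt≡N)
        where
        X^gt≈1 : pow X (g ℕ.* t) ≈ 1#
        X^gt≈1 = trans (sym (pow-* X g t)) (trans (pow-cong t X^g≈1) (pow-1 t))

        l*gt≡N : l ℕ.* (g ℕ.* t) ≡ N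
        l*gt≡N = ≡.trans (ℕ.*-comm l (g ℕ.* t)) (≡.trans (ℕ.*-assoc g t l)
          (≡.trans (ℕ.*-comm g (t ℕ.* l)) (≡.sym (≡.trans N≡sg (≡.cong (ℕ._* g) s≡tl)))))

      -- `p` divides `1 + N = p ^ m`; if it divided `N` too, it would divide `1`.
      p∤N : ¬ p ∣ N
      p∤N p∣N = prime∤! p-prime 0 (ℕ.>-nonZero⁻¹ p)
        (ℕ.∣m+n∣m⇒∣n (≡.subst (p ∣_) (≡.trans (≡.sym q≡) (ℕ.+-comm 1 N)) (p∣p^ m m≢0)) p∣N)
        where
        p∣p^ : ∀ m → m ≢ 0 → p ∣ p ℕ.^ m
        p∣p^ zero    m≢0 = contradiction ≡.refl m≢0
        p∣p^ (suc m) _   = ℕ.m∣m*n (p ℕ.^ m)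

      1≈0 : 1# ≈ 0#
      1≈0 with l , l∣N , l≈0 ← prime≈0
        with w , 1+wl≋0 ← negative-inverse p-prime (+ l)
          (λ l≋0 → p∤N (ℕ.∣-trans
            (≡.subst (p ∣_) (≡.cong ℤ.∣_∣ (ℤ.+-identityʳ (+ l))) (ℤ∣.∣⇒∣ᵤ (≋⇒∣ l≋0))) l∣N)) = begin
        con 1ℤ                       ≈⟨ +-identityʳ (con 1ℤ) ⟨
        con 1ℤ + con 0ℤ              ≈⟨ +-congˡ (trans (*-congˡ {con w} l≈0) (zeroʳ (con w))) ⟨
        con 1ℤ + con w * con (+ l)   ≈⟨ +-congˡ (con-* v w (+ l)) ⟨
        con 1ℤ + con (w ℤ.* + l)     ≈⟨ con-+ v 1ℤ (w ℤ.* + l) ⟨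
        con (1ℤ ℤ.+ w ℤ.* + l)       ≈⟨ con-cong v 1+wl≋0 ⟩
        con 0ℤ                       ∎

    -- Multiplying by `X^(N-i)`, the inverse of `X^i`, turns the equation into `X^(j-i) = 1`, which
    -- `order` forbids.
    powers-distinct : ∀ {i j} → i ℕ.< j → j ℕ.< N → ¬ pow X i ≈ pow X j
    powers-distinct {i} {j} i<j j<N X^i≈X^j =
      order (j ℕ.∸ i) (ℕ.m<n⇒0<n∸m i<j) (ℕ.≤-<-trans (ℕ.m∸n≤m j i) j<N) (begin
        pow X k                              ≈⟨ trans (*-congʳ X^r*X^i≈1) (*-identityˡ (pow X k)) ⟨
        (pow X r * pow X i) * pow X k        ≈⟨ *-assoc (pow X r) (pow X i) (pow X k) ⟩
        pow X r * (pow X i * pow X k)        ≈⟨ *-congˡ {pow X r} (pow-+ X i k) ⟨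
        pow X r * pow X (i ℕ.+ k)            ≡⟨ ≡.cong (λ n → pow X r * pow X n) (ℕ.m+[n∸m]≡n (ℕ.<⇒≤ i<j)) ⟩
        pow X r * pow X j                    ≈⟨ *-congˡ {pow X r} X^i≈X^j ⟨
        pow X r * pow X i                    ≈⟨ X^r*X^i≈1 ⟩
        1#                                   ∎)
      where
      k = j ℕ.∸ i
      r = N ℕ.∸ i

      X^r*X^i≈1 : pow X r * pow X i ≈ 1#
      X^r*X^i≈1 = begin
        pow X r * pow X i   ≈⟨ pow-+ X r i ⟨
        pow X (r ℕ.+ i)     ≡⟨ ≡.cong (pow X) (ℕ.m∸n+n≡m (ℕ.<⇒≤ (ℕ.<-trans i<j j<N))) ⟩
        pow X N             ≈⟨ period adm ⟩
        1#                  ∎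

    -- The quotient by a relation of least degree.

    module _ {d} (b : Vec (Fin p) d) (relation : pow X d ≈ combination b)
             (minimal : ∀ {d′} → d′ ℕ.< d → ¬ Annihilated d′) where

      -- Otherwise the sequence act x v would satisfy a monic relation of degree less than d.
      combination≈0 : ∀ {d′} → d′ ℕ.≤ d → ∀ {x} → ¬ x ≈ 0# →
        (c : Vec (Fin p) d′) → combination c * x ≈ 0# → c ≡ 0⃗
      combination≈0 d′≤d x≉0 [] _ = ≡.refl
      combination≈0 {suc n} n<d {x} x≉0 (z ∷ cs) c*x≈0 with digit z ≋? 0ℤ
      ... | yes z≋0 = ≡.cong₂ _∷_ (digit-injective (≋-trans z≋0 (≋-sym (digit-residue 0ℤ))))
        (combination≈0 (ℕ.<⇒≤ n<d) x≉0 cs (begin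
          combination cs * x                            ≈⟨ *-congʳ (+-identityˡ (combination cs)) ⟨
          (0# + combination cs) * x
            ≈⟨ *-congʳ (+-congʳ (trans (*-congʳ (con-cong v z≋0)) (zeroˡ (pow X n)))) ⟨
          combination (z ∷ cs) * x                      ≈⟨ c*x≈0 ⟩
          0#                                            ∎))
      ... | no z≉0 with w , 1+wz≋0 ← negative-inverse p-prime (digit z) z≉0 =
        contradiction annihilated (minimal n<d)
        where
        module W = CommutativeRing (cyclic p (act x v))

        annihilated : Annihilated n
        annihilated = act x v , Admissible-act x adm
          , (λ 1≈0 → x≉0 (trans (sym (*-identityˡ x)) (≈0⇒⊗≈0 p {f = con 1ℤ} x 1≈0)))
          , affine w 0⃗ cs
          , W.trans (RingLemmas.solve-leading (cyclic p (act x v)) {con (digit z)} {con w} {pow X n}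
              (W.trans (W.sym (W.trans (con-+ (act x v) 1ℤ _) (W.+-congˡ (con-* (act x v) w (digit z)))))
                (con-cong (act x v) 1+wz≋0))
              (⊗≈0⇒≈0 p {f = combination (z ∷ cs)} x c*x≈0))
            (W.sym (W.trans (combination-affine (act x v) w 0⃗ cs)
              (W.trans (W.+-congʳ (combination-0⃗ (act x v) n)) (W.+-identityˡ _))))

      combination-injective : ∀ {c c′ : Vec (Fin p) d} → combination c ≈ combination c′ → c ≡ c′
      combination-injective {c} {c′} eq = affine-injective c c′ (combination≈0 ℕ.≤-refl 1≉0 _ (begin
        combination (affine -1ℤ c c′) * 1#        ≈⟨ *-identityʳ _ ⟩
        combination (affine -1ℤ c c′)             ≈⟨ combination-affine v -1ℤ c c′ ⟩
        combination c + con -1ℤ * combination c′  ≈⟨ +-congʳ eq ⟩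
        combination c′ - combination c′           ≈⟨ -‿inverseʳ (combination c′) ⟩
        0#                                        ∎))

      Spanned : Expr → Set
      Spanned e = ∃ λ (c : Vec (Fin p) d) → e ≈ combination c

      -- Multiplying an element already spanned, instead of spanning `e` directly, reduces a product
      -- to two recursive calls; only the case `X` needs the relation.
      spanned-* : ∀ e {f} → Spanned f → Spanned (e * f)
      spanned-* (con z) {f} (c , f≈c) = affine z 0⃗ c , (begin
        con z * f                             ≈⟨ *-congˡ f≈c ⟩
        con z * combination c                 ≈⟨ trans (+-congʳ (combination-0⃗ v d)) (+-identityˡ _) ⟨
        combination 0⃗ + con z * combination c ≈⟨ combination-affine v z 0⃗ c ⟨
        combination (affine z 0⃗ c)            ∎)
      spanned-* X (c , f≈c) = lfsr b c , trans (*-congˡ f≈c) (sym (combination-lfsr v relation c))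
      spanned-* (e ⊕ e′) {f} s with spanned-* e s | spanned-* e′ s
      ... | c , ef≈c | c′ , e′f≈c′ = affine 1ℤ c c′ , (begin
        (e + e′) * f                            ≈⟨ distribʳ f e e′ ⟩
        e * f + e′ * f                          ≈⟨ +-cong ef≈c (trans e′f≈c′ (sym (*-identityˡ _))) ⟩
        combination c + con 1ℤ * combination c′ ≈⟨ combination-affine v 1ℤ c c′ ⟨
        combination (affine 1ℤ c c′)            ∎)
      spanned-* (e ⊗ e′) {f} s with c , eq ← spanned-* e (spanned-* e′ s) = c , trans (*-assoc e e′ f) eq

      spanned : ∀ e → Spanned e
      spanned e = let c , eq = spanned-* e (spanned-1 d relation) in c , trans (sym (*-identityʳ e)) eq
        where
        spanned-1 : ∀ d {b : Vec (Fin p) d} → pow X d ≈ combination b →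
          ∃ λ (c : Vec (Fin p) d) → 1# ≈ combination c
        -- In degree zero the relation reads `1 = 0`, as the empty combination is zero.
        spanned-1 zero    {[]} rel = contradiction rel 1≉0
        spanned-1 (suc n) rel with c , c≈1 ← one-combination v n = c , sym c≈1

      -- Minimality enters here: `y` has coordinates `c` with `combination c * x` zero, and
      -- `combination≈0` forces them to vanish. Thus the quotient is a domain.
      cancel : ∀ {x y} → ¬ x ≈ 0# → x * y ≈ 0# → y ≈ 0#
      cancel {x} {y} x≉0 xy≈0 with c , y≈c ← spanned y = begin
        y             ≈⟨ y≈c ⟩
        combination c ≡⟨ ≡.cong combination (combination≈0 ℕ.≤-refl x≉0 c (begin
          combination c * x ≈⟨ *-congʳ y≈c ⟨
          y * x             ≈⟨ *-comm y x ⟩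
          x * y             ≈⟨ xy≈0 ⟩
          0#                ∎)) ⟩
        combination 0⃗ ≈⟨ combination-0⃗ v d ⟩
        0#            ∎

      -- Otherwise `x` and the `N` powers of `X` would be `N + 1` distinct roots of `y^N - 1`.
      power : ∀ x → ¬ x ≈ 0# → ∃ λ (i : Fin N) → x ≈ pow X (toℕ i)
      power x x≉0 with Fin.any? (λ (i : Fin N) → x ≈? pow X (toℕ i))
      ... | yes found = found
      ... | no ¬power = contradiction roots (too-many-roots 1≉0 cancel f r distinct)
        where
        -- This is `y^N - 1` in the format of `monic`: constant term `-1`, then `N - 1` zeros, the
        -- leading `1` being implicit.
        f : Vec Expr N
        f = con -1ℤ ∷ replicate N′ 0#

        r : Fin (suc N) → Expr
        r zero    = x
        r (suc i) = pow X (toℕ i)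

        distinct : ∀ i j → i ≢ j → ¬ r i ≈ r j
        distinct zero    zero    i≢j eq = i≢j ≡.refl
        distinct zero    (suc j) i≢j eq = ¬power (j , eq)
        distinct (suc i) zero    i≢j eq = ¬power (i , sym eq)
        distinct (suc i) (suc j) i≢j eq with ℕ.<-cmp (toℕ i) (toℕ j)
        ... | tri< i<j _ _ = powers-distinct i<j (Fin.toℕ<n j) eq
        ... | tri≈ _ i≡j _ = i≢j (≡.cong suc (Fin.toℕ-injective i≡j))
        ... | tri> _ _ j<i = powers-distinct j<i (Fin.toℕ<n i) (sym eq)

        monic-power : ∀ n y → monic (replicate n 0#) y ≈ pow y n
        monic-power zero    y = refl
        monic-power (suc n) y = trans (+-identityˡ _) (*-congˡ (monic-power n y))

        root : ∀ y → pow y N ≈ 1# → monic f y ≈ 0#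
        root y y^N≈1 = begin
          con -1ℤ + y * monic (replicate N′ 0#) y ≈⟨ +-congˡ (*-congˡ (monic-power N′ y)) ⟩
          con -1ℤ + pow y N                       ≈⟨ +-congˡ y^N≈1 ⟩
          con -1ℤ + con 1ℤ                        ≈⟨ con-+ v -1ℤ 1ℤ ⟨
          0#                                      ∎

        roots : ∀ i → monic f (r i) ≈ 0#
        -- `x (x^N - 1) = x^(N+1) - x` vanishes by `fixed`, and the nonzero factor `x` is cancelled.
        roots zero    = root x (x-y≈0⇒x≈y (cancel x≉0 (begin
          x * (pow x N - 1#)          ≈⟨ distribˡ x (pow x N) (- 1#) ⟩
          x * pow x N + x * - 1#      ≈⟨ +-cong (fixed x) (*-comm x (- 1#)) ⟩
          x + (- 1#) * x              ≈⟨ +-congˡ (*-congʳ (*-identityʳ (con -1ℤ))) ⟩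
          x - x                       ≈⟨ -‿inverseʳ x ⟩
          0#                          ∎)))
        roots (suc i) = root (pow X (toℕ i)) (trans (pow-* X (toℕ i) N)
          (trans (reflexive (≡.cong (pow X) (ℕ.*-comm (toℕ i) N))) (pow-period (toℕ i))))

      nonzero : ∀ {c : Vec (Fin p) d} → c ≢ 0⃗ → ¬ combination c ≈ 0#
      nonzero c≢0 c≈0 = c≢0 (combination-injective (trans c≈0 (sym (combination-0⃗ v d))))

      -- The field has p^d elements by spanned, and 1 + N = p^m by power.
      degree : d ≡ m
      degree = exponent (ℕ.≤-antisym
        (≡.subst (p ℕ.^ d ℕ.≤_) q≡ (Fin.injective⇒≤ index-injective))
        (≡.subst (ℕ._≤ p ℕ.^ d) q≡ (Fin.injective⇒≤ coordinates-injective)))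
        where
        element : Fin (suc N) → Expr
        element zero    = 0#
        element (suc i) = pow X (toℕ i)

        find : ∀ x → ∃ λ i → x ≈ element i
        find x with x ≈? 0#
        ... | yes x≈0 = zero , x≈0
        ... | no x≉0 with i , eq ← power x x≉0 = suc i , eq

        index : Fin (p ℕ.^ d) → Fin (suc N)
        index i = proj₁ (find (combination (decode {p} {d} i)))

        index-injective : ∀ {i j} → index i ≡ index j → i ≡ j
        index-injective {i} {j} eq = ≡.trans (≡.sym (encode-decode {p} {d} i)) (≡.trans
          (≡.cong encode (combination-injective (trans (proj₂ (find _))
            (trans (reflexive (≡.cong element eq)) (sym (proj₂ (find _)))))))
          (encode-decode {p} {d} j))

        element-injective : ∀ {i j} → element i ≈ element j → i ≡ j
        element-injective {zero}  {zero}  eq = ≡.refl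
        element-injective {zero}  {suc j} eq = contradiction (sym eq) (power≉0 j)
          where
          power≉0 : ∀ (j : Fin N) → ¬ pow X (toℕ j) ≈ 0#
          power≉0 j X^j≈0 = 1≉0 (begin
            1#                                 ≈⟨ period adm ⟨
            pow X N                            ≡⟨ ≡.cong (pow X) (ℕ.m∸n+n≡m (ℕ.<⇒≤ (Fin.toℕ<n j))) ⟨
            pow X (N ℕ.∸ toℕ j ℕ.+ toℕ j)      ≈⟨ pow-+ X (N ℕ.∸ toℕ j) (toℕ j) ⟩
            pow X (N ℕ.∸ toℕ j) * pow X (toℕ j) ≈⟨ *-congˡ {pow X (N ℕ.∸ toℕ j)} X^j≈0 ⟩
            pow X (N ℕ.∸ toℕ j) * 0#           ≈⟨ zeroʳ (pow X (N ℕ.∸ toℕ j)) ⟩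
            0#                                 ∎)
        element-injective {suc i} {zero}  eq = ≡.sym (element-injective {zero} {suc i} (sym eq))
        element-injective {suc i} {suc j} eq with ℕ.<-cmp (toℕ i) (toℕ j)
        ... | tri< i<j _ _ = contradiction eq (powers-distinct i<j (Fin.toℕ<n j))
        ... | tri≈ _ i≡j _ = ≡.cong suc (Fin.toℕ-injective i≡j)
        ... | tri> _ _ j<i = contradiction (sym eq) (powers-distinct j<i (Fin.toℕ<n i))

        coordinates : Fin (suc N) → Fin (p ℕ.^ d)
        coordinates i = encode (proj₁ (spanned (element i)))

        coordinates-injective : ∀ {i j} → coordinates i ≡ coordinates j → i ≡ j
        coordinates-injective {i} {j} eq = element-injective (trans (proj₂ (spanned (element i)))
          (trans (reflexive (≡.cong combination (≡.trans (≡.sym (decode-encode _))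
              (≡.trans (≡.cong decode eq) (decode-encode _)))))
            (sym (proj₂ (spanned (element j))))))

        1<p : 1 ℕ.< p
        1<p = ℕ.nonTrivial⇒n>1 p {{prime⇒nonTrivial p-prime}}

        exponent : p ℕ.^ d ≡ p ℕ.^ m → d ≡ m
        exponent eq with ℕ.<-cmp d m
        ... | tri< d<m _ _ = contradiction eq (ℕ.<⇒≢ (ℕ.^-monoʳ-< p 1<p d<m))
        ... | tri≈ _ d≡m _ = d≡m
        ... | tri> _ _ m<d = contradiction (≡.sym eq) (ℕ.<⇒≢ (ℕ.^-monoʳ-< p 1<p m<d))

      combination-iterate : ∀ c k → combination (iterate (lfsr b) k c) ≈ pow X k * combination c
      combination-iterate c zero    = sym (*-identityˡ _)
      combination-iterate c (suc k) = trans (combination-lfsr v relation (iterate (lfsr b) k c))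
        (trans (*-congˡ {X} (combination-iterate c k)) (sym (*-assoc X (pow X k) _)))

      -- `combination` is injective and turns `lfsr b` into multiplication by `X`. Starting from the
      -- coordinates `y` of `1`, the iterates hold those of the powers of `X`, which reach every
      -- nonzero element.
      lfsr-primitive : ∃ λ y → lfsr b 0⃗ ≡ 0⃗ × y ≢ 0⃗ × iterate (lfsr b) N y ≡ y ×
        (∀ z → z ≢ 0⃗ → ∃ λ k → k ℕ.< N × iterate (lfsr b) k y ≡ z)
      lfsr-primitive with y , 1≈y ← spanned 1# = y
        , combination-injective (trans (combination-lfsr v relation 0⃗)
            (trans (*-congˡ {X} (combination-0⃗ v d)) (trans (zeroʳ X) (sym (combination-0⃗ v d)))))
        , (λ y≡0 → 1≉0 (trans 1≈y (trans (reflexive (≡.cong combination y≡0)) (combination-0⃗ v d))))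
        , combination-injective (trans (combination-iterate y N)
            (trans (*-congʳ {_} {pow X N} (period adm)) (*-identityˡ _)))
        , λ z z≢0 → let i , z≈X^i = power (combination z) (nonzero z≢0) in
            toℕ i , Fin.toℕ<n i , combination-injective (trans (combination-iterate y (toℕ i))
              (trans (*-congˡ {pow X (toℕ i)} (sym 1≈y)) (trans (*-identityʳ _) (sym z≈X^i))))

  -- The minimal degree exists only under a double negation, which primitive-lfsr removes because
  -- Primitive is decidable.
  minimal-witness : ∀ {P : ℕ → Set} d → P d → ¬ ¬ ∃ λ d′ → P d′ × (∀ {d″} → d″ ℕ.< d′ → ¬ P d″)
  minimal-witness {P} d Pd none = below (suc d) d ℕ.≤-refl Pd
    where
    below : ∀ n d → d ℕ.< n → ¬ P d
    below (suc n) d d<1+n Pd = none (d , Pd , λ d″<d → below n _ (ℕ.<-≤-trans d″<d (ℕ.s≤s⁻¹ d<1+n)))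

  -- The periodicity `X^N = 1` is itself a monic relation of degree `N`, so there is a degree to
  -- minimise from.
  annihilated : Annihilated N
  annihilated with v , adm , v0≡1 ← admissible-sequence p N =
    v , adm , nontrivial , c , trans (period adm) (sym c≈1)
    where
    open CommutativeRing (cyclic p v) using (trans; sym)

    c : Vec (Fin p) N
    c = proj₁ (one-combination v N′)

    c≈1 : Agree p v (combination c) (con 1ℤ)
    c≈1 = proj₂ (one-combination v N′)

    nontrivial : Nontrivial v
    nontrivial (agree 1≈0) = prime∤! p-prime 0 (ℕ.>-nonZero⁻¹ p) (ℤ∣.∣⇒∣ᵤ (≋⇒∣ 1≋0))
      where
      1≋0 : 1ℤ ≋ 0ℤ
      1≋0 = ≡.subst (λ a → 1ℤ ℤ.* a ≋ 0ℤ ℤ.* a) v0≡1 (1≈0 0)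

  primitive-exists : ¬ ¬ ∃ λ b → ∃ λ y → Primitive b y
  primitive-exists none = minimal-witness {Annihilated} N annihilated λ
    (d , (v , adm , 1≉0 , b , rel) , minimal) → go d v adm 1≉0 b rel minimal
    where
    -- The degree is kept as a variable so that the equation `d ≡ m` can be matched by `refl`.
    go : ∀ d v (adm : Admissible p N v) (1≉0 : Nontrivial v) (b : Vec (Fin p) d)
      (rel : Agree p v (pow X d) (combination b)) →
      ¬ (∀ {d′} → d′ ℕ.< d → ¬ Annihilated d′)
    go d v adm 1≉0 b rel minimal with ≡.refl ← degree v adm 1≉0 b rel minimal =
      none (b , lfsr-primitive v adm 1≉0 b rel minimal)

-- Finite search for a primitive register.

module _ {m n : ℕ} {P : Vec (Fin m) n → Set} (P? : ∀ xs → Dec (P xs)) where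

  all-vectors? : Dec (∀ xs → P xs)
  all-vectors? = map′ (λ h xs → ≡.subst P (decode-encode xs) (h (encode xs))) (λ h i → h (decode i))
    (Fin.all? (λ i → P? (decode i)))

  any-vector? : Dec (∃ P)
  any-vector? = map′ (λ (i , h) → decode i , h)
    (λ (xs , h) → encode xs , ≡.subst P (≡.sym (decode-encode xs)) h)
    (Fin.any? (λ i → P? (decode i)))

module _ {p m N′ : ℕ} (p-prime : Prime p) (m≢0 : m ≢ 0) (q≡ : suc (suc N′) ≡ p ℕ.^ m) where

  open Primitivity p m N′ p-prime m≢0 q≡
  open Digits p

  private
    infix 4 _≟_
    _≟_ : (xs ys : Vec (Fin p) m) → Dec (xs ≡ ys)
    _≟_ = Vec.≡-dec Fin._≟_

    primitive? : ∀ b y → Dec (Primitive b y)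
    primitive? b y = lfsr b 0⃗ ≟ 0⃗ ×-dec ¬? (y ≟ 0⃗) ×-dec iterate (lfsr b) N y ≟ y ×-dec
      all-vectors? λ z → ¬? (z ≟ 0⃗) →-dec ℕ.anyUpTo? (λ k → iterate (lfsr b) k y ≟ z) N

  primitive-lfsr : ∃ λ b → ∃ λ y → Primitive b y
  primitive-lfsr = decidable-stable (any-vector? λ b → any-vector? λ y → primitive? b y) primitive-exists

-- The automata network of a register.

-- At the last position no `s` exists and the hypothesis is empty; there both lookups give the
-- appended `z`.
lookup-∷ʳ-local : ∀ {A : Set} {n} (xs ys : Vec A n) z t →
  (∀ s → toℕ s ≡ toℕ t → lookup xs s ≡ lookup ys s) → lookup (xs ∷ʳ z) t ≡ lookup (ys ∷ʳ z) t
lookup-∷ʳ-local []       []       z t       h = ≡.refl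
lookup-∷ʳ-local (x ∷ xs) (y ∷ ys) z zero    h = h zero ≡.refl
lookup-∷ʳ-local (x ∷ xs) (y ∷ ys) z (suc t) h = lookup-∷ʳ-local xs ys z t λ s eq → h (suc s) (≡.cong suc eq)

-- Digit j of the symbol in cell i is the digit n j + i of the register, so that the shift reads
-- cell i + 1 mod n and the feedback reads cell 0.
module _ (p k n : ℕ) .{{_ : NonZero p}} .{{_ : NonZero n}} where

  open Digits p

  split : Config (p ℕ.^ k) n → Vec (Fin p) (k ℕ.* n)
  split x = tabulate λ t → let j , i = remQuot {k} n t in finToFun (lookup x i) j

  merge : Vec (Fin p) (k ℕ.* n) → Config (p ℕ.^ k) n
  merge s = tabulate λ i → funToFin {k} λ j → lookup s (combine j i)

  split-merge : ∀ s → split (merge s) ≡ s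
  split-merge s = ≡.trans (Vec.tabulate-cong λ t → let j , i = remQuot {k} n t in
    ≡.trans (≡.cong (λ a → finToFun a j) (Vec.lookup∘tabulate _ i))
      (≡.trans (Fin.finToFun-funToFin {k} {p} (λ j → lookup s (combine j i)) j)
        (≡.cong (lookup s) (Fin.combine-remQuot {k} n t))))
    (Vec.tabulate∘lookup s)

  lookup-split : ∀ x j i → lookup (split x) (combine j i) ≡ finToFun (lookup x i) j
  lookup-split x j i = ≡.trans (Vec.lookup∘tabulate _ (combine j i))
    (≡.cong (λ (j , i) → finToFun (lookup x i) j) (Fin.remQuot-combine {k} {n} j i))

  merge-split : ∀ x → merge (split x) ≡ x
  merge-split x = ≡.trans (Vec.tabulate-cong λ i →
    ≡.trans (funToFin-cong {p} {k} (λ j → lookup-split x j i)) (Fin.funToFin-finToFin {k} {p} (lookup x i)))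
    (Vec.tabulate∘lookup x)

  cell : Fin (k ℕ.* n) → Fin n
  cell t = proj₂ (remQuot {k} n t)

  toℕ-cell : ∀ t → toℕ (cell t) ≡ toℕ t % n
  toℕ-cell t = ≡.trans (≡.sym (m<n⇒m%n≡m (Fin.toℕ<n i))) (≡.trans (≡.sym ([m+kn]%n≡m%n (toℕ i) (toℕ j) n))
    (≡.cong (_% n) (≡.trans (≡.sym toℕ-combine) (≡.cong toℕ (Fin.combine-remQuot {k} n t)))))
    where
    j = proj₁ (remQuot {k} n t)
    i = cell t

    toℕ-combine : toℕ (combine j i) ≡ toℕ i ℕ.+ toℕ j ℕ.* n
    toℕ-combine = ≡.trans (Fin.toℕ-combine j i)
      (≡.trans (ℕ.+-comm (n ℕ.* toℕ j) (toℕ i)) (≡.cong (toℕ i ℕ.+_) (ℕ.*-comm n (toℕ j))))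

  next : Fin n → Fin n
  next i = suc (toℕ i) mod n

  first : Fin n
  first = 0 mod n

  -- Working modulo `n` treats the step from cell `n - 1` back to cell `0` like all others.
  cell-next : ∀ s t → toℕ s ≡ suc (toℕ t) → cell s ≡ next (cell t)
  cell-next s t eq = Fin.toℕ-injective (≡.trans (toℕ-cell s) (≡.trans (≡.cong (_% n) eq)
    (≡.trans (%-suc (toℕ t)) (≡.trans (≡.cong (λ a → suc a % n) (≡.sym (toℕ-cell t)))
      (≡.sym (Fin.toℕ-fromℕ< (m%n<n (suc (toℕ (cell t))) n)))))))
    where
    %-suc : ∀ a → suc a % n ≡ suc (a % n) % n
    %-suc a = ≡.trans (≡.cong (λ a → suc a % n) (m≡m%n+[m/n]*n a n)) ([m+kn]%n≡m%n (suc (a % n)) (a / n) n)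

  cell-first : ∀ s → toℕ s ≡ 0 → cell s ≡ first
  cell-first s eq = Fin.toℕ-injective (≡.trans (toℕ-cell s) (≡.trans (≡.cong (_% n) eq)
    (≡.sym (Fin.toℕ-fromℕ< (m%n<n 0 n)))))

  -- Digit `t` of `lfsr b c` is digit `t + 1` of `c`, or the appended zero, plus `lookup b t` times
  -- the leading digit, which has index `0`. Positions are compared by `toℕ`, so the second
  -- hypothesis is empty at the last digit.
  lfsr-local : ∀ {l} (b c c′ : Vec (Fin p) l) t →
    (∀ s → toℕ s ≡ 0 → lookup c s ≡ lookup c′ s) →
    (∀ s → toℕ s ≡ suc (toℕ t) → lookup c s ≡ lookup c′ s) →
    lookup (lfsr b c) t ≡ lookup (lfsr b c′) t
  lfsr-local b (c ∷ cs) (c′ ∷ cs′) t h₀ h₁ with ≡.refl ← h₀ zero ≡.refl =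
    ≡.trans (Vec.lookup-zipWith _ t (cs ∷ʳ _) b) (≡.trans
      (≡.cong (λ a → residue (digit a ℤ.+ digit c ℤ.* digit (lookup b t)))
        (lookup-∷ʳ-local cs cs′ _ t λ s eq → h₁ (suc s) (≡.cong suc eq)))
      (≡.sym (Vec.lookup-zipWith _ t (cs′ ∷ʳ _) b)))

  module _ (b : Vec (Fin p) (k ℕ.* n)) where

    network : AutomataNetwork (p ℕ.^ k) n
    network x = merge (lfsr b (split x))

    local-dependence : ∀ i {x x′} → lookup x first ≡ lookup x′ first → lookup x (next i) ≡ lookup x′ (next i) →
      local network i x ≡ local network i x′
    local-dependence i {x} {x′} h₀ h₁ = ≡.trans (Vec.lookup∘tabulate _ i) (≡.trans
      (funToFin-cong {p} {k} λ j → lfsr-local b (split x) (split x′) (combine j i)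
        (λ s eq → agreeing s (cell-first s eq) h₀)
        (λ s eq → agreeing s (≡.trans (cell-next s (combine j i) eq)
          (≡.cong next (≡.cong proj₂ (Fin.remQuot-combine {k} {n} j i)))) h₁))
      (≡.sym (Vec.lookup∘tabulate _ i)))
      where
      agreeing : ∀ s {i} → cell s ≡ i → lookup x i ≡ lookup x′ i → lookup (split x) s ≡ lookup (split x′) s
      agreeing s ≡.refl h = ≡.trans (Vec.lookup∘tabulate _ s)
        (≡.trans (≡.cong (λ a → finToFun a (proj₁ (remQuot {k} n s))) h) (≡.sym (Vec.lookup∘tabulate _ s)))

    network-degree : DegreeAtMost network 2
    network-degree j = first List.∷ next j List.∷ List.[] , ℕ.≤-refl , sources
      where
      sources : ∀ i → Arc network i j → i ∈ first List.∷ next j List.∷ List.[]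
      sources i (x , x′ , same , differ) with i Fin.≟ first | i Fin.≟ next j
      ... | yes i≡first | _          = here i≡first
      ... | no _        | yes i≡next = there (here i≡next)
      ... | no i≢first  | no i≢next  = contradiction
        (local-dependence j {x} {x′} (same first (i≢first ∘ ≡.sym)) (same (next j) (i≢next ∘ ≡.sym))) differ

    network-merge : ∀ s → network (merge s) ≡ merge (lfsr b s)
    network-merge s = ≡.cong (merge ∘ lfsr b) (split-merge s)

    iterate-network : ∀ t s → iterate network t (merge s) ≡ merge (iterate (lfsr b) t s)
    iterate-network zero    s = ≡.refl
    iterate-network (suc t) s = ≡.trans (≡.cong network (iterate-network t s)) (network-merge (iterate (lfsr b) t s))

  -- `merge` is a bijection with inverse `split` that conjugates `lfsr b` to the network, so the
  -- fixed point and the cycle carry over.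
  near-hamiltonian : ∀ {N} (b y : Vec (Fin p) (k ℕ.* n)) → N ≡ (p ℕ.^ k) ℕ.^ n ℕ.∸ 1 →
    lfsr b 0⃗ ≡ 0⃗ → y ≢ 0⃗ → iterate (lfsr b) N y ≡ y →
    (∀ z → z ≢ 0⃗ → ∃ λ t → t ℕ.< N × iterate (lfsr b) t y ≡ z) → NearHamiltonian (network b)
  near-hamiltonian b y ≡.refl fixed-point y≢0 periodic transitive =
    merge 0⃗ , ≡.trans (network-merge b 0⃗) (≡.cong merge fixed-point)
    , merge y , (λ eq → y≢0 (≡.trans (≡.sym (split-merge y)) (≡.trans (≡.cong split eq) (split-merge 0⃗))))
    , ≡.trans (iterate-network b ((p ℕ.^ k) ℕ.^ n ℕ.∸ 1) y) (≡.cong merge periodic)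
    , orbit
    where
    orbit : ∀ z → z ≢ merge 0⃗ → Σ ℕ λ t → t ℕ.< (p ℕ.^ k) ℕ.^ n ℕ.∸ 1 × iterate (network b) t (merge y) ≡ z
    orbit z z≢0 with t , t<N , eq ← transitive (split z)
      (λ eq → z≢0 (≡.trans (≡.sym (merge-split z)) (≡.cong merge eq))) =
      t , t<N , ≡.trans (iterate-network b t y) (≡.trans (≡.cong merge eq) (merge-split z))

-- Networks over alphabets of prime power size.

near-hamiltonian-network : ∀ {p} k n → Prime p → 0 ℕ.< k ℕ.* n →
  Σ (AutomataNetwork (p ℕ.^ k) n) λ F → DegreeAtMost F 2 × NearHamiltonian F
near-hamiltonian-network {p} k zero p-prime 0<m = contradiction (ℕ.*-zeroʳ k) (ℕ.>⇒≢ 0<m)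
near-hamiltonian-network {p} k n@(suc _) p-prime 0<m =
  go (p ℕ.^ (k ℕ.* n)) ≡.refl (ℕ.^-monoʳ-< p (ℕ.nonTrivial⇒n>1 p {{prime⇒nonTrivial p-prime}}) 0<m)
  where
  instance _ = prime⇒nonZero p-prime

  -- As `p ^ (k n)` exceeds `1`, it can be matched as `N′ + 2`, which shows the cycle length
  -- `N′ + 1` as a successor.
  go : ∀ q → q ≡ p ℕ.^ (k ℕ.* n) → 1 ℕ.< q →
    Σ (AutomataNetwork (p ℕ.^ k) n) λ F → DegreeAtMost F 2 × NearHamiltonian F
  go (suc zero)     _  (ℕ.s≤s ())
  go (suc (suc N′)) q≡ _ =
    let b , y , fixed-point , y≢0 , periodic , transitive = primitive-lfsr p-prime (ℕ.>⇒≢ 0<m) q≡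
    in network p k n b , network-degree p k n b
      , near-hamiltonian p k n b y (≡.cong (ℕ._∸ 1) (≡.trans q≡ (≡.sym (ℕ.^-*-assoc p k n))))
          fixed-point y≢0 periodic transitive

theorem2 : (q n : ℕ) → IsPrimePower q → n ≥ 2 →
    Σ (AutomataNetwork q n) λ F → DegreeAtMost F 2 × NearHamiltonian F
theorem2 _ n (p , k , p-prime , ≡.refl) n≥2 = near-hamiltonian-network (suc k) n p-prime
  (ℕ.*-mono-< {0} {suc k} {0} {n} ℕ.z<s (ℕ.<-trans ℕ.z<s n≥2))
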